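{- Let $p$ be a prime and $k,\ell,m$ integers with $k>0$ and $\ell,m\ge 0$; put $q=p^k$, $Q=p^{\ell}$, $R=p^m$. Let $c\in\mathbb{F}_{q^3}$ and define \[ f(X)=(X^q-X)^{Q+1}+c^{q^2}X^{q^2R}+c^{q}X^{qR}+cX^{R}, \] i.e. $f(X)=X^{Q+1}\circ(X^q-X)+(X^{q^2}+X^q+X)\circ cX^{R}$. Then $f(X)$ permutes $\mathbb{F}_{q^3}$ if and only if $\gcd(q-1,Q+1)=1$ and $\operatorname{Tr}_{\mathbb{F}_{q^3}/\mathbb{F}_q}(c)\ne 0$. Equivalently, $f(X)$ permutes $\mathbb{F}_{q^3}$ if and only if $p=2$, $\operatorname{ord}_2(k)\le\operatorname{ord}_2(\ell)$, and $c^{q^2}+c^q+c\ne 0$.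
   Context: A polynomial permutes $\mathbb{F}_{q^3}$ if the induced map $\mathbb{F}_{q^3}\to\mathbb{F}_{q^3}$ is a bijection. $\operatorname{Tr}_{\mathbb{F}_{q^3}/\mathbb{F}_q}(c)=c^{q^2}+c^q+c$. For a nonzero integer $N$, $\operatorname{ord}_2(N)$ is the largest integer $s\ge0$ with $2^s\mid N$, and $\operatorname{ord}_2(0)=\infty$. -}

module Defs where

open import Algebra.Apartness.Bundles using (HeytingField; HeytingCommutativeRing)
open import Algebra.Bundles using (CommutativeRing)
open import Algebra.Bundles.Raw using (RawRing)
import Algebra.Definitions.RawSemiring as RawSemiringDefs
import Algebra.Properties.Semiring.Exp as SemiringExp
open import Data.Fin.Base using (Fin)
open import Data.List.Base using (List; []; _∷_; map; foldr)
open import Data.Nat.Base as ℕ using (ℕ; zero; suc)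
open import Data.Nat.Divisibility using (_∣_; _∣?_; 1∣_; ∣⇒≤)
import Data.Nat.Properties as ℕ
open import Data.Product.Base using (_×_; _,_)
open import Function.Bundles using (Inverse)
open import Function.Definitions using (Bijective)
open import Level using (Level; _⊔_)
open import Relation.Binary.Bundles using (Setoid)
open import Relation.Binary.Construct.Add.Supremum.NonStrict ℕ._≤_ using (_≤⁺_) public
open import Relation.Binary.PropositionalEquality using (_≡_; refl; setoid)
open import Relation.Nullary using (yes; no)
open import Relation.Nullary.Construct.Add.Supremum using (_⁺; ⊤⁺; [_])
open import Relation.Unary using (Pred; Decidable)

private
  variable
    a ℓ ℓ₁ ℓ₂ : Level

-- The largest s ≤ n satisfying P (0 if there is none).
largest : {P : Pred ℕ ℓ} → Decidable P → ℕ → ℕ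
largest P? zero = zero
largest P? (suc n) with P? (suc n)
... | yes _ = suc n
... | no  _ = largest P? n

-- Searching up to N suffices because s < 2 ^ s ≤ N whenever 2 ^ s ∣ N ≠ 0;
-- see ord₂-largest.
ord₂ : ℕ → ℕ ⁺
ord₂ zero      = ⊤⁺
ord₂ N@(suc _) = [ largest (λ s → 2 ℕ.^ s ∣? N) N ]

largest-sat : {P : Pred ℕ ℓ} (P? : Decidable P) → P 0 → ∀ n → P (largest P? n)
largest-sat P? P0 zero = P0
largest-sat P? P0 (suc n) with P? (suc n)
... | yes Pn = Pn
... | no  _  = largest-sat P? P0 n

largest-upper : {P : Pred ℕ ℓ} (P? : Decidable P) →
                ∀ n s → s ℕ.≤ n → P s → s ℕ.≤ largest P? n
largest-upper P? zero s s≤0 Ps = s≤0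
largest-upper {P = P} P? (suc n) s s≤n Ps with P? (suc n)
... | yes _  = s≤n
... | no ¬Pn = largest-upper P? n s (ℕ.s≤s⁻¹ (ℕ.≤∧≢⇒< s≤n λ { refl → ¬Pn Ps })) Ps

n<2^n : ∀ n → n ℕ.< 2 ℕ.^ n
n<2^n zero    = ℕ.s≤s ℕ.z≤n
n<2^n (suc n) = ℕ.≤-trans (ℕ.+-mono-≤ (ℕ.>-nonZero⁻¹ _ {{ℕ.m^n≢0 2 n}}) (n<2^n n))
                  (ℕ.+-monoʳ-≤ (2 ℕ.^ n) (ℕ.m≤m+n (2 ℕ.^ n) 0))

ord₂-largest : ∀ N s → N ℕ.> 0 → ord₂ N ≡ [ s ] →
               2 ℕ.^ s ∣ N × (∀ t → 2 ℕ.^ t ∣ N → t ℕ.≤ s)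
ord₂-largest N@(suc _) _ _ refl =
  largest-sat (λ s → 2 ℕ.^ s ∣? N) (1∣ N) N ,
  λ t d → largest-upper (λ s → 2 ℕ.^ s ∣? N) N t
            (ℕ.≤-trans (ℕ.<⇒≤ (n<2^n t)) (∣⇒≤ d)) d

HasCardinality : Setoid a ℓ → ℕ → Set (a ⊔ ℓ)
HasCardinality S n = Inverse S (setoid (Fin n))

-- Univariate polynomials as lists of coefficients, constant term first.
-- Trailing zeros are allowed, so equality compares coefficients.
module Polynomial (K : CommutativeRing a ℓ) where
  open CommutativeRing K

  Poly : Set a
  Poly = List Carrier

  coeff : Poly → ℕ → Carrier
  coeff []      _       = 0#
  coeff (x ∷ u) zero    = x
  coeff (x ∷ u) (suc i) = coeff u i

  C : Carrier → Poly
  C x = x ∷ []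

  X : Poly
  X = 0# ∷ 1# ∷ []

  addₚ : Poly → Poly → Poly
  addₚ []      v       = v
  addₚ u       []      = u
  addₚ (x ∷ u) (y ∷ v) = x + y ∷ addₚ u v

  mulₚ : Poly → Poly → Poly
  mulₚ []      v = []
  mulₚ (x ∷ u) v = addₚ (map (x *_) v) (0# ∷ mulₚ u v)

  polyRawRing : RawRing a ℓ
  polyRawRing = record
    { Carrier = Poly
    ; _≈_     = λ u v → ∀ i → coeff u i ≈ coeff v i
    ; _+_     = addₚ
    ; _*_     = mulₚ
    ; -_      = map (-_)
    ; 0#      = []
    ; 1#      = C 1#
    }

  eval : Poly → Carrier → Carrier
  eval u x = foldr (λ y r → y + x * r) 0# u

  Permutes : Poly → Set (a ⊔ ℓ)
  Permutes u = Bijective _≈_ _≈_ (eval u)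

-- Meant for F with q ³ elements, i.e. 𝔽_{q³}. The apartness of a finite Heyting
-- field coincides with _≉_, so F is then a field in the classical sense.
module CubicExtension (F : HeytingField a ℓ₁ ℓ₂) (q : ℕ) where
  private
    K : CommutativeRing a ℓ₁
    K = HeytingCommutativeRing.commutativeRing (HeytingField.heytingCommutativeRing F)

    module K where
      open CommutativeRing K public
      open SemiringExp semiring public using (_^_)

  open CommutativeRing K public using (Carrier; _≉_; 0#) renaming (setoid to fieldSetoid)
  open Polynomial K public

  Tr : Carrier → Carrier
  Tr c = c K.^ (q ℕ.^ 2) K.+ c K.^ q K.+ c

  f : (Q R : ℕ) → Carrier → Poly
  f Q R c = (X ^ q + - X) ^ (Q ℕ.+ 1)
          + C (c K.^ (q ℕ.^ 2)) * X ^ (q ℕ.^ 2 ℕ.* R)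
          + C (c K.^ q) * X ^ (q ℕ.* R)
          + C c * X ^ R
    where
    open RawRing polyRawRing using (_+_; _*_; -_; rawSemiring)
    open RawSemiringDefs rawSemiring using (_^_)

{-# OPTIONS --safe #-}

-- Put ∂ x = x^q - x. Then f(x) = (∂ x)^(Q+1) + Tr(c x^R), where the second term lies
-- in 𝔽_q and is semilinear over 𝔽_q.
--
-- If Tr c = 0, then f vanishes at 0 and 1. If d = gcd (q - 1) (Q + 1) ≠ 1, there is
-- u ≠ 1 in 𝔽_q with u^(Q+1) = 1, and f(u x + a) = f(x) for a suitable a in 𝔽_q, while
-- ∂ (u x + a) = u ∂ x. The gcd condition forces p = 2 and ord₂ k ≤ ord₂ ℓ by exhibiting
-- the common factors 2 and 2^(2^t) + 1 with t = ord₂ ℓ.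
--
-- Conversely let p = 2, let f(x) = f(z), and put g = (∂ x)^(Q+1). Then g + g^q and its
-- conjugates are determined. With y = ∂ x and U = y + ω y^q in 𝔽_{q³}[ω], ω² + ω + 1 = 0,
-- these sums give the coordinates of U^(Q+1) if ℓ is even, and of U^Q times the conjugate
-- of U if ℓ is odd. In the second case k is odd and the conjugate of U has q-th power ω U,
-- so U^(Qq+1) is determined. Either exponent is injective on 𝔽_{q³}[ω], so ∂ x = ∂ z;
-- finally x - z lies in 𝔽_q and (x - z)^R Tr c = 0.
module Submission where

open import Defs
open import Algebra.Apartness.Bundles using (HeytingField; HeytingCommutativeRing)
open import Algebra.Bundles using (CommutativeMonoid; CommutativeRing)
open import Algebra.Bundles.Raw using (RawRing)
import Algebra.Definitions.RawSemiring as RawSemiringDefs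
import Algebra.Properties.CommutativeMonoid.Mult as CommutativeMonoidMult
import Algebra.Properties.CommutativeMonoid.Sum as CommutativeMonoidSum
import Algebra.Properties.CommutativeSemiring.Binomial as Binomial
import Algebra.Properties.CommutativeSemiring.Exp as Exp
import Algebra.Properties.Monoid.Sum as MonoidSum
import Algebra.Properties.Ring as RingProperties
import Algebra.Properties.Semiring.Mult as SemiringMult
import Algebra.Solver.Ring.NaturalCoefficients.Default as SemiringSolver
open import Data.Fin.Base using (Fin; zero; suc; toℕ; fromℕ; inject₁; inject≤)
import Data.Fin.Permutation as Perm
open import Data.Fin.Properties as Fin
  using (any?; punchInᵢ≢i; punchIn-injective; punchOut-injective; inject≤-injective; toℕ-inject₁; toℕ<n; toℕ-fromℕ)
open import Data.List.Base using ([]; _∷_; map)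
open import Data.Nat.Base as ℕ using (ℕ; zero; suc; NonZero; s≤s; z≤n)
open import Data.Nat.Combinatorics using (_C_; nCn≡1; nCk≡n!/k![n-k]!; k![n∸k]!∣n!)
open import Data.Nat.DivMod using (m/n*n≡m)
open import Data.Nat.Divisibility
  using (_∣_; divides; _∣?_; ∣-reflexive; ∣-trans; ∣m+n∣m⇒∣n; ∣n⇒∣m*n; ∣1⇒≡1; ∣⇒≤)
open import Data.Nat.GCD using (gcd; gcd-greatest; gcd[m,n]∣m; gcd[m,n]∣n)
open import Data.Nat.Primality
  using (Prime; prime[2]; euclidsLemma; prime⇒irreducible; prime⇒nonTrivial; prime⇒nonZero)
import Data.Nat.Properties as ℕ
open import Data.Nat.Properties using (_!*_!≢0)
open import Data.Nat.Solver using (module +-*-Solver)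
open import Data.Product.Base as Prod using (_,_; proj₁; proj₂; ∃; ∃-syntax)
open import Data.Sum.Base using (_⊎_; inj₁; inj₂)
open import Data.Vec.Functional using (removeAt)
open import Function.Base using (_∘_)
open import Function.Bundles using (Inverse; _⇔_; mk⇔)
open import Function.Definitions using (Injective; Bijective; Congruent)
open import Level using (Level; _⊔_)
open import Relation.Binary.Bundles using (Setoid)
open import Relation.Binary.Construct.Add.Supremum.NonStrict ℕ._≤_ using ([_]; _≤⊤⁺)
open import Relation.Binary.PropositionalEquality as ≡ using (_≡_; _≢_)
import Relation.Binary.Reasoning.Setoid as SetoidReasoning
open import Relation.Nullary using (¬_; Dec; yes; no; ¬?; contradiction)
open import Relation.Nullary.Construct.Add.Supremum using (⊤⁺; [_])
open import Relation.Nullary.Decidable as Dec using (decidable-stable; _×-dec_)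

private
  variable
    a ℓ ℓ₁ ℓ₂ : Level

-- Natural numbers: divisibility, powers of two in `k` and `ℓ`, and the gcd condition.

module _ where
  open import Data.Nat.Base using (_+_; _*_; _^_; _∸_; _≤_; _<_; _>_; _!)
  open +-*-Solver using (solve; _:+_; _:*_; _:^_; _:=_; con)
  open ≡ using (refl; cong; subst)

  even⊎odd : ∀ n → (∃[ i ] n ≡ 2 * i) ⊎ (∃[ i ] n ≡ 1 + 2 * i)
  even⊎odd zero = inj₁ (0 , refl)
  even⊎odd (suc n) with even⊎odd n
  ... | inj₁ (i , refl) = inj₂ (i , refl)
  ... | inj₂ (i , refl) = inj₁ (suc i , cong suc (≡.sym (ℕ.+-suc i (i + 0))))

  -- Induction on `i` by x²(x^(2i+1) + 1) = (x - 1)(x + 1) + (x^(2i+3) + 1); writing x = 1 + z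
  -- avoids subtraction.
  x+1∣x^odd+1 : ∀ x .{{_ : NonZero x}} i → x + 1 ∣ x ^ (1 + 2 * i) + 1
  x+1∣x^odd+1 x zero = ∣-reflexive (cong (_+ 1) (≡.sym (ℕ.*-identityʳ x)))
  x+1∣x^odd+1 x@(suc z) (suc i) =
    ∣m+n∣m⇒∣n (subst (x + 1 ∣_) eq (∣n⇒∣m*n (x * x) (x+1∣x^odd+1 x i))) (divides z refl)
    where
    eq : x * x * (x ^ (1 + 2 * i) + 1) ≡ z * (x + 1) + (x ^ (1 + 2 * suc i) + 1)
    eq = ≡.trans
      (solve 2 (λ z w → let x = con 1 :+ z in
          x :* x :* (x :* w :+ con 1) := z :* (x :+ con 1) :+ (x :* (x :* (x :* w)) :+ con 1))
        refl z (x ^ (2 * i)))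
      (cong (λ e → z * (x + 1) + (x ^ suc e + 1)) (≡.sym (ℕ.*-suc 2 i)))

  -- The congruence (1 + z)^j ≡ 1 modulo z with an explicit quotient. It serves for x - 1 ∣ x^j - 1,
  -- for powers of y² modulo y² - 1, and for the parity of powers of an odd number.
  suc-^ : ∀ z j → ∃[ c ] suc z ^ j ≡ 1 + c * z
  suc-^ z zero = 0 , refl
  suc-^ z (suc j) with c , eq ← suc-^ z j =
    1 + c + c * z , ≡.trans (cong (suc z *_) eq)
      (solve 2 (λ z c → (con 1 :+ z) :* (con 1 :+ c :* z) := con 1 :+ (con 1 :+ c :+ c :* z) :* z)
        refl z c)

  x-1∣x^j-1 : ∀ x .{{_ : NonZero x}} j → x ∸ 1 ∣ x ^ j ∸ 1
  x-1∣x^j-1 (suc z) j with c , eq ← suc-^ z j = divides c (cong (_∸ 1) eq)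

  prime∤! : ∀ {p} → Prime p → ∀ n → n < p → ¬ (p ∣ n !)
  prime∤! pr zero n<p d = contradiction (∣1⇒≡1 d) (ℕ.nonTrivial⇒≢1 {{prime⇒nonTrivial pr}})
  prime∤! pr (suc n) n<p d with euclidsLemma (suc n) (n !) pr d
  ... | inj₁ p∣n = ℕ.<⇒≱ n<p (∣⇒≤ p∣n)
  ... | inj₂ p∣n! = prime∤! pr n (ℕ.<-trans (ℕ.n<1+n n) n<p) p∣n!

  ^-monoʳ-∣ : ∀ x {m n} → m ≤ n → x ^ m ∣ x ^ n
  ^-monoʳ-∣ x {m} {n} m≤n = divides (x ^ (n ∸ m))
    (≡.trans (cong (x ^_) (≡.sym (ℕ.m∸n+n≡m m≤n))) (ℕ.^-distribˡ-+-* x (n ∸ m) m))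

  private
    -- An even cofactor of 2^s would let 2^(s+1) divide `N`, against the maximality in
    -- `ord₂-largest`.
    ord₂-split : ∀ N s → N > 0 → ord₂ N ≡ [ s ] → ∃[ o ] N ≡ 2 ^ s * (1 + 2 * o)
    ord₂-split N s N>0 eq with ord₂-largest N s N>0 eq
    ... | divides m N≡m*2^s , max with even⊎odd m
    ... | inj₂ (o , refl) = o , ≡.trans N≡m*2^s (ℕ.*-comm _ (2 ^ s))
    ... | inj₁ (i , refl) = contradiction (max (suc s) (divides i (≡.trans N≡m*2^s
            (solve 2 (λ i w → con 2 :* i :* w := i :* (con 2 :* w)) refl i (2 ^ s)))))
            ℕ.1+n≰n

  -- The form in which sufficiency uses the order condition: `s` is the order of `k`, whose cofactor
  -- is odd, while the cofactor `j` of `ℓ` is arbitrary. The infinite order of `ℓ = 0` gives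
  -- `j = 0`.
  ord₂-≤⇒split : ∀ k ℓ → k > 0 → ord₂ k ≤⁺ ord₂ ℓ →
                 ∃[ s ] ∃[ o ] ∃[ j ] (k ≡ 2 ^ s * (1 + 2 * o) Prod.× ℓ ≡ 2 ^ s * j)
  ord₂-≤⇒split k@(suc _) zero k>0 _ =
    let s = largest (λ s → 2 ^ s ∣? k) k
        o , eq = ord₂-split k s k>0 refl
    in s , o , 0 , eq , ≡.sym (ℕ.*-zeroʳ (2 ^ s))
  ord₂-≤⇒split k@(suc _) ℓ@(suc _) k>0 [ s≤t ] =
    let s = largest (λ s → 2 ^ s ∣? k) k
        t = largest (λ s → 2 ^ s ∣? ℓ) ℓ
        o , eq = ord₂-split k s k>0 refl
        divides j eq′ = ∣-trans (^-monoʳ-∣ 2 s≤t) (proj₁ (ord₂-largest ℓ t (s≤s z≤n) refl))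
    in s , o , j , eq , ≡.trans eq′ (ℕ.*-comm j (2 ^ s))

  private
    -- The factor is y + 1 with y = 2^(2^t): it divides y² - 1, hence y^(2m) - 1, and it divides
    -- y^(1+2o) + 1 because the exponent is odd.
    common-factor : ∀ ℓ k t o m → ℓ ≡ 2 ^ t * (1 + 2 * o) → k ≡ 2 ^ t * (2 * m) →
                    ∃[ d ] d ≢ 1 Prod.× d ∣ 2 ^ k ∸ 1 Prod.× d ∣ 2 ^ ℓ + 1
    common-factor ℓ k t o m refl refl with 2 ^ (2 ^ t) in eq
    ... | zero = contradiction eq (ℕ.≢-nonZero⁻¹ _ {{ℕ.m^n≢0 2 (2 ^ t)}})
    ... | y@(suc z) = y + 1 , (λ e → contradiction (ℕ.+-cancelʳ-≡ 1 y 0 e) λ ()) , d₁ , d₂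
      where
      open ≡.≡-Reasoning
      pow : ∀ e → 2 ^ (2 ^ t * e) ≡ y ^ e
      pow e = ≡.trans (≡.sym (ℕ.^-*-assoc 2 (2 ^ t) e)) (cong (_^ e) eq)
      d₁ : y + 1 ∣ 2 ^ (2 ^ t * (2 * m)) ∸ 1
      d₁ with c , e ← suc-^ (z * (y + 1)) m = divides (c * z) (cong (_∸ 1) (begin
        2 ^ (2 ^ t * (2 * m))        ≡⟨ pow (2 * m) ⟩
        y ^ (2 * m)                  ≡⟨ ℕ.^-*-assoc y 2 m ⟨
        (y ^ 2) ^ m                  ≡⟨ cong (_^ m) (solve 1 (λ z → let y = con 1 :+ z in
            y :^ 2 := con 1 :+ z :* (y :+ con 1)) refl z) ⟩
        (1 + z * (y + 1)) ^ m        ≡⟨ e ⟩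
        1 + c * (z * (y + 1))        ≡⟨ cong suc (ℕ.*-assoc c z (y + 1)) ⟨
        1 + c * z * (y + 1)          ∎))
      d₂ : y + 1 ∣ 2 ^ (2 ^ t * (1 + 2 * o)) + 1
      d₂ = subst (λ e → y + 1 ∣ e + 1) (≡.sym (pow (1 + 2 * o))) (x+1∣x^odd+1 y o)

  -- By contradiction: if the order of `k` exceeds t = `ord₂ ℓ`, then `k` is a multiple of 2^(t+1),
  -- and `common-factor` gives a nontrivial common divisor.
  gcd≡1⇒ord₂-≤ : ∀ k ℓ → k > 0 → gcd (2 ^ k ∸ 1) (2 ^ ℓ + 1) ≡ 1 → ord₂ k ≤⁺ ord₂ ℓ
  gcd≡1⇒ord₂-≤ k zero _ _ = _ ≤⊤⁺
  gcd≡1⇒ord₂-≤ k@(suc _) ℓ@(suc _) k>0 g≡1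
    with ord₂ k in eqk | ord₂ ℓ in eqℓ
  ... | _ | ⊤⁺ = _ ≤⊤⁺
  ... | ⊤⁺ | [ t ] = contradiction eqk λ ()
  ... | [ s ] | [ t ] with s ℕ.≤? t
  ... | yes s≤t = [ s≤t ]
  ... | no s≰t with o , ℓ≡ ← ord₂-split ℓ t (s≤s z≤n) eqℓ
                  | divides m k≡ , _ ← ord₂-largest k s k>0 eqk =
      let m₁ = m * 2 ^ (s ∸ suc t)
          d , d≢1 , d∣₁ , d∣₂ = common-factor ℓ k t o m₁ ℓ≡ (begin
            k                                     ≡⟨ k≡ ⟩
            m * 2 ^ s                             ≡⟨ cong (λ e → m * 2 ^ e) (ℕ.m∸n+n≡m (ℕ.≰⇒> s≰t)) ⟨
            m * 2 ^ (s ∸ suc t + suc t)           ≡⟨ cong (m *_) (ℕ.^-distribˡ-+-* 2 (s ∸ suc t) (suc t)) ⟩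
            m * (2 ^ (s ∸ suc t) * (2 * 2 ^ t))   ≡⟨ solve 3 (λ a b c → a :* (b :* (con 2 :* c)) := c :* (con 2 :* (a :* b))) refl m (2 ^ (s ∸ suc t)) (2 ^ t) ⟩
            2 ^ t * (2 * m₁)                      ∎)
      in contradiction (∣1⇒≡1 (subst (d ∣_) g≡1 (gcd-greatest d∣₁ d∣₂))) d≢1
      where open ≡.≡-Reasoning

  -- For odd `p` both p^k - 1 and p^ℓ + 1 are even.
  gcd≡1⇒p≡2 : ∀ p k ℓ → Prime p → gcd (p ^ k ∸ 1) (p ^ ℓ + 1) ≡ 1 → p ≡ 2
  gcd≡1⇒p≡2 p k ℓ pr g≡1 with even⊎odd p
  ... | inj₁ (i , p≡2i) with prime⇒irreducible pr (divides i (≡.trans p≡2i (ℕ.*-comm 2 i)))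
  ...   | inj₂ 2≡p = ≡.sym 2≡p
  gcd≡1⇒p≡2 p k ℓ pr g≡1 | inj₂ (i , refl)
    with c , eq ← suc-^ (2 * i) k | c′ , eq′ ← suc-^ (2 * i) ℓ =
    contradiction (∣1⇒≡1 (subst (2 ∣_) g≡1 (gcd-greatest
      (divides (c * i) (cong (_∸ 1) (≡.trans eq (cong suc (solve 2 (λ c i → c :* (con 2 :* i) := c :* i :* con 2) refl c i)))))
      (divides (c′ * i + 1) (≡.trans (cong (_+ 1) eq′)
        (solve 2 (λ c i → con 1 :+ c :* (con 2 :* i) :+ con 1 := (c :* i :+ con 1) :* con 2) refl c′ i)))))) λ ()

  -- The prime divides p! = C(p,k) k! (p-k)!, but neither of the two factorials of numbers below p.
  prime∣C : ∀ {p} → Prime p → ∀ k → 0 < k → k < p → p ∣ p C k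
  prime∣C {p} pr k 0<k k<p with euclidsLemma (p C k) (k ! * (p ∸ k) !) pr p∣p!
    where
    instance
      _ = k !* (p ∸ k) !≢0
    p∣p! : p ∣ (p C k) * (k ! * (p ∸ k) !)
    p∣p! = subst (p ∣_) (≡.sym (≡.trans
      (cong (_* (k ! * (p ∸ k) !)) (nCk≡n!/k![n-k]! (ℕ.<⇒≤ k<p)))
      (m/n*n≡m (k![n∸k]!∣n! (ℕ.<⇒≤ k<p))))) (p∣m! p (ℕ.<-trans 0<k k<p))
      where
      p∣m! : ∀ m → 0 < m → m ∣ m !
      p∣m! (suc m) _ = divides (m !) (ℕ.*-comm (suc m) (m !))
  ... | inj₁ p∣C = p∣C
  ... | inj₂ p∣k![p-k]! with euclidsLemma (k !) ((p ∸ k) !) pr p∣k![p-k]!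
  ...   | inj₁ p∣k! = contradiction p∣k! (prime∤! pr k k<p)
  ...   | inj₂ p∣[p-k]! = contradiction p∣[p-k]!
            (prime∤! pr (p ∸ k) (ℕ.∸-monoʳ-< 0<k (ℕ.<⇒≤ k<p)))

-- Additivity of the Frobenius map in characteristic p.

CharacteristicDivides : CommutativeRing a ℓ → ℕ → Set ℓ
CharacteristicDivides K p = p × 1# ≈ 0#
  where
  open CommutativeRing K
  open SemiringMult semiring using (_×_)

module Frobenius (K : CommutativeRing a ℓ) {p : ℕ} (pr : Prime p)
  (p×1≈0 : CharacteristicDivides K p) where

  open CommutativeRing K hiding (zero)
  open Exp commutativeSemiring
  open SemiringMult semiring using (_×_; ×-congˡ; ×-assocˡ; ×-assoc-*; ×-congʳ; ×-homo-1)
  open MonoidSum +-monoid using (sum; sum-init-last; sum-cong-≋; sum-replicate-zero)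
  open SetoidReasoning setoid

  p×x≈0 : ∀ x → p × x ≈ 0#
  p×x≈0 x = begin
    p × x          ≈⟨ ×-congʳ p (*-identityˡ x) ⟨
    p × (1# * x)   ≈⟨ ×-assoc-* p 1# x ⟨
    p × 1# * x     ≈⟨ *-congʳ p×1≈0 ⟩
    0# * x         ≈⟨ zeroˡ x ⟩
    0#             ∎

  ∣⇒×≈0 : ∀ {m} → p ∣ m → ∀ x → m × x ≈ 0#
  ∣⇒×≈0 (divides c ≡.refl) x = begin
    (c ℕ.* p) × x  ≈⟨ ×-congˡ (ℕ.*-comm c p) ⟩
    (p ℕ.* c) × x  ≈⟨ ×-assocˡ x p c ⟨
    p × (c × x)    ≈⟨ p×x≈0 (c × x) ⟩
    0#             ∎

  -- Split the first and the last term off the binomial sum; the coefficients in between are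
  -- divisible by `p`. The auxiliary `expand` has a variable exponent that can be matched as a
  -- successor.
  [x+y]^p : ∀ x y → (x + y) ^ p ≈ x ^ p + y ^ p
  [x+y]^p x y = expand p ≡.refl
    where
    expand : ∀ m → m ≡ p → (x + y) ^ m ≈ x ^ m + y ^ m
    expand zero    ≡.refl with () ← prime⇒nonTrivial pr
    expand (suc m) ≡.refl = begin
      (x + y) ^ suc m
        ≈⟨ Binomial.theorem commutativeSemiring (suc m) x y ⟩
      term zero + sum (λ i → term (suc i))
        ≈⟨ +-congˡ (sum-init-last (λ i → term (suc i))) ⟩
      term zero + (sum (λ i → term (suc (inject₁ i))) + term (suc (fromℕ m)))
        ≈⟨ +-cong first (+-cong middle last) ⟩
      y ^ suc m + (0# + x ^ suc m)
        ≈⟨ +-congˡ (+-identityˡ _) ⟩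
      y ^ suc m + x ^ suc m
        ≈⟨ +-comm _ _ ⟩
      x ^ suc m + y ^ suc m ∎
      where
      term : Fin (suc (suc m)) → Carrier
      term = Binomial.binomialTerm commutativeSemiring x y (suc m)
      first : term zero ≈ y ^ suc m
      first = trans (×-homo-1 _) (*-identityˡ _)
      middle : sum (λ i → term (suc (inject₁ i))) ≈ 0#
      middle = trans
        (sum-cong-≋ λ i → ∣⇒×≈0
          (prime∣C pr (suc (toℕ (inject₁ i))) (s≤s z≤n)
            (s≤s (≡.subst (ℕ._< m) (≡.sym (toℕ-inject₁ i)) (toℕ<n i)))) _)
        (sum-replicate-zero m)
      last : term (suc (fromℕ m)) ≈ x ^ suc m
      last rewrite toℕ-fromℕ m | nCn≡1 (suc m) | ℕ.n∸n≡0 m =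
        trans (×-homo-1 _) (*-identityʳ _)

  [x+y]^p^n : ∀ n x y → (x + y) ^ (p ℕ.^ n) ≈ x ^ (p ℕ.^ n) + y ^ (p ℕ.^ n)
  [x+y]^p^n zero    x y = trans (*-identityʳ _) (+-cong (sym (*-identityʳ x)) (sym (*-identityʳ y)))
  [x+y]^p^n (suc n) x y = begin
    (x + y) ^ (p ℕ.* p ℕ.^ n)                    ≈⟨ ^-assocʳ (x + y) p (p ℕ.^ n) ⟨
    ((x + y) ^ p) ^ (p ℕ.^ n)                    ≈⟨ ^-congˡ (p ℕ.^ n) ([x+y]^p x y) ⟩
    (x ^ p + y ^ p) ^ (p ℕ.^ n)                  ≈⟨ [x+y]^p^n n (x ^ p) (y ^ p) ⟩
    (x ^ p) ^ (p ℕ.^ n) + (y ^ p) ^ (p ℕ.^ n)    ≈⟨ +-cong (^-assocʳ x p (p ℕ.^ n)) (^-assocʳ y p (p ℕ.^ n)) ⟩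
    x ^ (p ℕ.* p ℕ.^ n) + y ^ (p ℕ.* p ℕ.^ n)    ∎

-- Injectivity of the (2^ℓ + 1)-th power in a commutative monoid.

module _ (M : CommutativeMonoid a ℓ) where
  open CommutativeMonoid M
  open CommutativeMonoidMult M
  open SetoidReasoning setoid

  -- In multiplicative terms: 2^ℓ + 1 divides 2^(ℓ (1 + 2 o)) + 1 = 2^(n j) + 1, so
  -- u^(2^ℓ + 1) determines u^(2^(n j)) u = u², and squaring is injective on the u
  -- with u^(2^n) = u.
  2^ℓ+1-power-injective : ∀ ℓ n .{{_ : NonZero n}} o j → ℓ ℕ.* (1 ℕ.+ 2 ℕ.* o) ≡ n ℕ.* j →
    ∀ {u v} → (2 ℕ.^ n) × u ≈ u → (2 ℕ.^ n) × v ≈ v →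
    (2 ℕ.^ ℓ ℕ.+ 1) × u ≈ (2 ℕ.^ ℓ ℕ.+ 1) × v → u ≈ v
  2^ℓ+1-power-injective ℓ (suc n) o j ℓ*odd≡n*j {u} {v} fix-u fix-v eq = begin
    u                          ≈⟨ fix-u ⟨
    (2 ℕ.* 2 ℕ.^ n) × u        ≈⟨ ×-congˡ (ℕ.*-comm 2 (2 ℕ.^ n)) ⟩
    (2 ℕ.^ n ℕ.* 2) × u        ≈⟨ ×-assocˡ u (2 ℕ.^ n) 2 ⟨
    (2 ℕ.^ n) × (2 × u)        ≈⟨ ×-congʳ (2 ℕ.^ n) squares ⟩
    (2 ℕ.^ n) × (2 × v)        ≈⟨ ×-assocˡ v (2 ℕ.^ n) 2 ⟩
    (2 ℕ.^ n ℕ.* 2) × v        ≈⟨ ×-congˡ (ℕ.*-comm 2 (2 ℕ.^ n)) ⟨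
    (2 ℕ.* 2 ℕ.^ n) × v        ≈⟨ fix-v ⟩
    v                          ∎
    where
    fix-iterate : ∀ {w} → (2 ℕ.^ suc n) × w ≈ w → ∀ i → (2 ℕ.^ (suc n ℕ.* i)) × w ≈ w
    fix-iterate {w} fix zero    = trans (×-congˡ (≡.cong (2 ℕ.^_) (ℕ.*-zeroʳ n))) (×-homo-1 w)
    fix-iterate {w} fix (suc i) = begin
      (2 ℕ.^ (suc n ℕ.* suc i)) × w              ≈⟨ ×-congˡ (≡.trans (≡.cong (2 ℕ.^_) (ℕ.*-suc (suc n) i)) (ℕ.^-distribˡ-+-* 2 (suc n) (suc n ℕ.* i))) ⟩
      (2 ℕ.^ suc n ℕ.* 2 ℕ.^ (suc n ℕ.* i)) × w  ≈⟨ ×-assocˡ w (2 ℕ.^ suc n) _ ⟨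
      (2 ℕ.^ suc n) × ((2 ℕ.^ (suc n ℕ.* i)) × w) ≈⟨ ×-congʳ (2 ℕ.^ suc n) (fix-iterate fix i) ⟩
      (2 ℕ.^ suc n) × w                          ≈⟨ fix ⟩
      w                                          ∎
    N = 2 ℕ.^ ℓ ℕ.+ 1
    N∣ : N ∣ 2 ℕ.^ (suc n ℕ.* j) ℕ.+ 1
    N∣ = ≡.subst (λ e → N ∣ e ℕ.+ 1)
      (≡.trans (ℕ.^-*-assoc 2 ℓ (1 ℕ.+ 2 ℕ.* o)) (≡.cong (2 ℕ.^_) ℓ*odd≡n*j))
      (x+1∣x^odd+1 (2 ℕ.^ ℓ) {{ℕ.m^n≢0 2 ℓ}} o)
    c = _∣_.quotient N∣
    square : ∀ {w} → (2 ℕ.^ suc n) × w ≈ w → 2 × w ≈ c × (N × w)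
    square {w} fix = begin
      2 × w                                       ≈⟨ ∙-congʳ (fix-iterate fix j) ⟨
      (2 ℕ.^ (suc n ℕ.* j)) × w ∙ (1 × w)         ≈⟨ ×-homo-+ w (2 ℕ.^ (suc n ℕ.* j)) 1 ⟨
      (2 ℕ.^ (suc n ℕ.* j) ℕ.+ 1) × w             ≈⟨ ×-congˡ (_∣_.equality N∣) ⟩
      (c ℕ.* N) × w                               ≈⟨ ×-assocˡ w c N ⟨
      c × (N × w)                                 ∎
    squares : 2 × u ≈ 2 × v
    squares = trans (square fix-u) (trans (×-congʳ c eq) (sym (square fix-v)))

-- Adjoining a primitive cube root of unity.

-- The pair (x , y) stands for x + y ω in K[ω] with ω² = 1 + ω. Only the
-- multiplication is needed.
module AdjoinCubeRoot (K : CommutativeRing a ℓ) where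
  open CommutativeRing K hiding (zero)

  open SemiringSolver commutativeSemiring using (solve; _:+_; _:*_; _:=_; con)

  infixl 7 _⊛_
  _⊛_ : Carrier Prod.× Carrier → Carrier Prod.× Carrier → Carrier Prod.× Carrier
  (x , y) ⊛ (z , w) = x * z + y * w , x * w + y * z + y * w

  private
    assoc₁ : ∀ x y z w s t → (x * z + y * w) * s + (x * w + y * z + y * w) * t
                           ≈ x * (z * s + w * t) + y * (z * t + w * s + w * t)
    assoc₁ = solve 6 (λ x y z w s t →
      (x :* z :+ y :* w) :* s :+ (x :* w :+ y :* z :+ y :* w) :* t
      := x :* (z :* s :+ w :* t) :+ y :* (z :* t :+ w :* s :+ w :* t)) refl

    assoc₂ : ∀ x y z w s t →
      (x * z + y * w) * t + (x * w + y * z + y * w) * s + (x * w + y * z + y * w) * t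
      ≈ x * (z * t + w * s + w * t) + y * (z * s + w * t) + y * (z * t + w * s + w * t)
    assoc₂ = solve 6 (λ x y z w s t →
      (x :* z :+ y :* w) :* t :+ (x :* w :+ y :* z :+ y :* w) :* s :+ (x :* w :+ y :* z :+ y :* w) :* t
      := x :* (z :* t :+ w :* s :+ w :* t) :+ y :* (z :* s :+ w :* t) :+ y :* (z :* t :+ w :* s :+ w :* t)) refl

    comm₁ : ∀ x y z w → x * z + y * w ≈ z * x + w * y
    comm₁ = solve 4 (λ x y z w → x :* z :+ y :* w := z :* x :+ w :* y) refl

    comm₂ : ∀ x y z w → x * w + y * z + y * w ≈ z * y + w * x + w * y
    comm₂ = solve 4 (λ x y z w → x :* w :+ y :* z :+ y :* w := z :* y :+ w :* x :+ w :* y) refl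

    identity₁ : ∀ x y → 1# * x + 0# * y ≈ x
    identity₁ = solve 2 (λ x y → con 1 :* x :+ con 0 :* y := x) refl

    identity₂ : ∀ x y → 1# * y + 0# * x + 0# * y ≈ y
    identity₂ = solve 2 (λ x y → con 1 :* y :+ con 0 :* x :+ con 0 :* y := y) refl

  ⊛-commutativeMonoid : CommutativeMonoid a ℓ
  ⊛-commutativeMonoid = record
    { Carrier = Carrier Prod.× Carrier
    ; _≈_ = λ { (x , y) (z , w) → x ≈ z Prod.× y ≈ w }
    ; _∙_ = _⊛_
    ; ε   = 1# , 0#
    ; isCommutativeMonoid = record
      { isMonoid = record
        { isSemigroup = record
          { isMagma = record
            { isEquivalence = record
              { refl  = refl , refl
              ; sym   = λ (p , q) → sym p , sym q
              ; trans = λ (p , q) (r , s) → trans p r , trans q s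
              }
            ; ∙-cong = λ (p , q) (r , s) → +-cong (*-cong p r) (*-cong q s)
                , +-cong (+-cong (*-cong p s) (*-cong q r)) (*-cong q s)
            }
          ; assoc = λ (x , y) (z , w) (s , t) → assoc₁ x y z w s t , assoc₂ x y z w s t
          }
        ; identity = (λ (x , y) → identity₁ x y , identity₂ x y)
            , λ (x , y) → trans (comm₁ x y 1# 0#) (identity₁ x y)
                        , trans (comm₂ x y 1# 0#) (identity₂ x y)
        }
      ; comm = λ (x , y) (z , w) → comm₁ x y z w , comm₂ x y z w
      }
    }

-- Characteristic two: the sums of conjugates of g determine ∂ x.

private
  module Exponents where
    open import Data.Nat.Base using (_+_; _*_)
    open +-*-Solver

    3∙2th≡2∙3th : ∀ t h → 3 * (2 * t * h) ≡ 2 * (3 * (t * h))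
    3∙2th≡2∙3th = solve 2 (λ t h → con 3 :* (con 2 :* t :* h) := con 2 :* (con 3 :* (t :* h))) ≡.refl

    -- This identity and the next two are the hypothesis of `2^ℓ+1-power-injective` in the three
    -- parity cases. The odd multiplier is always 1 + 2(1 + 3o) = 3(1 + 2o): it supplies the
    -- extension degree 3 and the odd part of `k`.
    even-even : ∀ t o j → 2 * (t * j) * (1 + 2 * (1 + 3 * o)) ≡ 2 * (3 * (t * (1 + 2 * o))) * j
    even-even = solve 3 (λ t o j →
      con 2 :* (t :* j) :* (con 1 :+ con 2 :* (con 1 :+ con 3 :* o))
      := con 2 :* (con 3 :* (t :* (con 1 :+ con 2 :* o))) :* j) ≡.refl

    odd-even : ∀ o i → 2 * i * (1 + 2 * (1 + 3 * o)) ≡ 2 * (3 * (1 + 2 * o)) * i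
    odd-even = solve 2 (λ o i →
      con 2 :* i :* (con 1 :+ con 2 :* (con 1 :+ con 3 :* o))
      := con 2 :* (con 3 :* (con 1 :+ con 2 :* o)) :* i) ≡.refl

    odd-odd : ∀ o i → (1 + 2 * i + (1 + 2 * o)) * (1 + 2 * (1 + 3 * o)) ≡ 2 * (3 * (1 + 2 * o)) * (1 + i + o)
    odd-odd = solve 2 (λ o i →
      (con 1 :+ con 2 :* i :+ (con 1 :+ con 2 :* o)) :* (con 1 :+ con 2 :* (con 1 :+ con 3 :* o))
      := con 2 :* (con 3 :* (con 1 :+ con 2 :* o)) :* (con 1 :+ i :+ o)) ≡.refl

module CharacteristicTwo (K : CommutativeRing a ℓ) (2×1≈0 : CharacteristicDivides K 2) where

  open CommutativeRing K hiding (zero)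
  open Exp commutativeSemiring
  open Frobenius K prime[2] 2×1≈0
  open AdjoinCubeRoot K
  open CommutativeMonoid ⊛-commutativeMonoid using ()
    renaming
    ( _≈_ to _≋_; setoid to ≋-setoid; refl to ≋-refl; sym to ≋-sym; trans to ≋-trans
    ; ∙-cong to ⊛-cong; assoc to ⊛-assoc )
  open CommutativeMonoidMult ⊛-commutativeMonoid using ()
    renaming
    ( _×_ to _⊠_; ×-congˡ to ⊠-congˡ; ×-congʳ to ⊠-congʳ; ×-homo-1 to ⊠-homo-1
    ; ×-homo-+ to ⊠-homo-+; ×-assocˡ to ⊠-assocˡ; ×-distrib-+ to ⊠-distrib-⊛ )
  open SetoidReasoning setoid

  open SemiringSolver commutativeSemiring using (solve; _:+_; _:*_; _:=_; con)

  x+x≈0 : ∀ x → x + x ≈ 0#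
  x+x≈0 x = trans (+-congˡ (sym (+-identityʳ x))) (p×x≈0 x)

  x+y+y≈x : ∀ x y → x + y + y ≈ x
  x+y+y≈x x y = trans (+-assoc x y y) (trans (+-congˡ (x+x≈0 y)) (+-identityʳ x))

  x+y≈z⇒x≈z+y : ∀ {x y z} → x + y ≈ z → x ≈ z + y
  x+y≈z⇒x≈z+y {x} {y} eq = trans (sym (x+y+y≈x x y)) (+-congʳ eq)

  private
    square-pair₁ : ∀ x y → x * (x * 1# + y * 0#) + y * (x * 0# + y * 1# + y * 0#)
                         ≈ x * (x * 1#) + y * (y * 1#)
    square-pair₁ = solve 2 (λ x y →
      x :* (x :* con 1 :+ y :* con 0) :+ y :* (x :* con 0 :+ y :* con 1 :+ y :* con 0)
      := x :* (x :* con 1) :+ y :* (y :* con 1)) refl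

    square-pair₂ : ∀ x y → x * (x * 0# + y * 1# + y * 0#) + y * (x * 1# + y * 0#) + y * (x * 0# + y * 1# + y * 0#)
                         ≈ y * (y * 1#) + x * y + x * y
    square-pair₂ = solve 2 (λ x y →
      x :* (x :* con 0 :+ y :* con 1 :+ y :* con 0) :+ y :* (x :* con 1 :+ y :* con 0) :+ y :* (x :* con 0 :+ y :* con 1 :+ y :* con 0)
      := y :* (y :* con 1) :+ x :* y :+ x :* y) refl

  -- Here `n ⊠ u` is the n-th power of u in K[ω]. The cross term 2xyω vanishes, and ω² = 1 + ω.
  square-pair : ∀ x y → 2 ⊠ (x , y) ≋ (x ^ 2 + y ^ 2 , y ^ 2)
  square-pair x y = square-pair₁ x y , trans (square-pair₂ x y) (x+y+y≈x _ _)

  -- Since ω⁴ = ω, raising to the fourth power acts coordinatewise; the induction squares twice at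
  -- each step.
  2^even-power : ∀ i x y → (2 ℕ.^ (2 ℕ.* i)) ⊠ (x , y) ≋ (x ^ (2 ℕ.^ (2 ℕ.* i)) , y ^ (2 ℕ.^ (2 ℕ.* i)))
  2^even-power zero x y = ≋-trans (⊠-homo-1 _) (sym (*-identityʳ x) , sym (*-identityʳ y))
  2^even-power (suc i) x y = ≋R.begin
    (2 ℕ.^ (2 ℕ.* suc i)) ⊠ (x , y)         ≋R.≈⟨ ⊠-congˡ quadruple ⟩
    (N ℕ.* 2 ℕ.* 2) ⊠ (x , y)               ≋R.≈⟨ ⊠-assocˡ (x , y) (N ℕ.* 2) 2 ⟨
    (N ℕ.* 2) ⊠ (2 ⊠ (x , y))               ≋R.≈⟨ ⊠-assocˡ (2 ⊠ (x , y)) N 2 ⟨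
    N ⊠ (2 ⊠ (2 ⊠ (x , y)))                 ≋R.≈⟨ ⊠-congʳ N (⊠-congʳ 2 (square-pair x y)) ⟩
    N ⊠ (2 ⊠ (x ^ 2 + y ^ 2 , y ^ 2))       ≋R.≈⟨ ⊠-congʳ N (square-pair (x ^ 2 + y ^ 2) (y ^ 2)) ⟩
    N ⊠ ((x ^ 2 + y ^ 2) ^ 2 + (y ^ 2) ^ 2 , (y ^ 2) ^ 2)
      ≋R.≈⟨ ⊠-congʳ N (trans (+-congʳ ([x+y]^p (x ^ 2) (y ^ 2))) (x+y+y≈x _ _) , refl) ⟩
    N ⊠ ((x ^ 2) ^ 2 , (y ^ 2) ^ 2)         ≋R.≈⟨ 2^even-power i _ _ ⟩
    (((x ^ 2) ^ 2) ^ N , ((y ^ 2) ^ 2) ^ N) ≋R.≈⟨ powers x , powers y ⟩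
    (x ^ (2 ℕ.^ (2 ℕ.* suc i)) , y ^ (2 ℕ.^ (2 ℕ.* suc i))) ≋R.∎
    where
    module ≋R = SetoidReasoning ≋-setoid
    N = 2 ℕ.^ (2 ℕ.* i)
    quadruple : 2 ℕ.^ (2 ℕ.* suc i) ≡ N ℕ.* 2 ℕ.* 2
    quadruple = ≡.trans (≡.cong (2 ℕ.^_) (ℕ.*-suc 2 i))
      (≡.trans (≡.cong (2 ℕ.*_) (ℕ.*-comm 2 N)) (ℕ.*-comm 2 (N ℕ.* 2)))
    powers : ∀ z → ((z ^ 2) ^ 2) ^ N ≈ z ^ (2 ℕ.^ (2 ℕ.* suc i))
    powers z = begin
      ((z ^ 2) ^ 2) ^ N              ≈⟨ ^-congˡ N (^-assocʳ z 2 2) ⟩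
      (z ^ 4) ^ N                    ≈⟨ ^-assocʳ z 4 N ⟩
      z ^ (4 ℕ.* N)                  ≈⟨ ^-congʳ z (≡.trans (≡.trans (ℕ.*-comm 4 N) (≡.sym (ℕ.*-assoc N 2 2))) (≡.sym quadruple)) ⟩
      z ^ (2 ℕ.^ (2 ℕ.* suc i))      ∎

  -- One squaring beyond the even case replaces ω by ω² = 1 + ω.
  2^odd-power : ∀ i x y → let N = 2 ℕ.^ (1 ℕ.+ 2 ℕ.* i) in
                N ⊠ (x , y) ≋ (x ^ N + y ^ N , y ^ N)
  2^odd-power i x y = ≋R.begin
    (2 ℕ.* N) ⊠ (x , y)                      ≋R.≈⟨ ⊠-assocˡ (x , y) 2 N ⟨
    2 ⊠ (N ⊠ (x , y))                        ≋R.≈⟨ ⊠-congʳ 2 (2^even-power i x y) ⟩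
    2 ⊠ (x ^ N , y ^ N)                      ≋R.≈⟨ square-pair (x ^ N) (y ^ N) ⟩
    ((x ^ N) ^ 2 + (y ^ N) ^ 2 , (y ^ N) ^ 2) ≋R.≈⟨ +-cong (double x) (double y) , double y ⟩
    (x ^ (2 ℕ.* N) + y ^ (2 ℕ.* N) , y ^ (2 ℕ.* N)) ≋R.∎
    where
    module ≋R = SetoidReasoning ≋-setoid
    N = 2 ℕ.^ (2 ℕ.* i)
    double : ∀ z → (z ^ N) ^ 2 ≈ z ^ (2 ℕ.* N)
    double z = trans (^-assocʳ z N 2) (^-congʳ z (ℕ.*-comm N 2))

  private
    ^[N+1] : ∀ N x → x ^ (N ℕ.+ 1) ≈ x ^ N * x
    ^[N+1] N x = trans (^-homo-* x N 1) (*-congˡ (*-identityʳ x))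

  -- Multiply U = x + yω by its N-th power, which is taken coordinatewise. When y = x^q and y^q = x
  -- + y, the sums `α` and `β` are g + g^q and its q-th power, for g = x^(N+1).
  even-power : ∀ i x y → let N = 2 ℕ.^ (2 ℕ.* i)
                             α = x ^ (N ℕ.+ 1) + y ^ (N ℕ.+ 1)
                             β = y ^ (N ℕ.+ 1) + (x + y) ^ (N ℕ.+ 1) in
               (N ℕ.+ 1) ⊠ (x , y) ≋ (α , α + β)
  even-power i x y = ≋-trans (⊠-homo-+ (x , y) N 1)
    (≋-trans (⊛-cong (2^even-power i x y) (⊠-homo-1 (x , y))) (sym α≈ , sym α+β≈))
    where
    N = 2 ℕ.^ (2 ℕ.* i)
    α≈ = +-cong (^[N+1] N x) (^[N+1] N y)
    β≈ = +-cong (^[N+1] N y)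
      (trans (^[N+1] N (x + y)) (*-congʳ ([x+y]^p^n (2 ℕ.* i) x y)))
    α+β≈ = begin
      _ ≈⟨ +-cong α≈ β≈ ⟩
      x ^ N * x + y ^ N * y + (y ^ N * y + (x ^ N + y ^ N) * (x + y))
        ≈⟨ solve 4 (λ X Y x y →
             X :* x :+ Y :* y :+ (Y :* y :+ (X :+ Y) :* (x :+ y))
             := X :* y :+ Y :* x :+ Y :* y :+ (X :* x :+ Y :* y) :+ (X :* x :+ Y :* y))
             refl (x ^ N) (y ^ N) x y ⟩
      x ^ N * y + y ^ N * x + y ^ N * y + (x ^ N * x + y ^ N * y) + (x ^ N * x + y ^ N * y)
        ≈⟨ x+y+y≈x _ _ ⟩
      x ^ N * y + y ^ N * x + y ^ N * y ∎

  -- (x + y , y) is the conjugate x + y ω² of (x , y).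
  odd-power : ∀ i x y → let N = 2 ℕ.^ (1 ℕ.+ 2 ℕ.* i)
                            α = x ^ (N ℕ.+ 1) + y ^ (N ℕ.+ 1)
                            β = y ^ (N ℕ.+ 1) + (x + y) ^ (N ℕ.+ 1) in
              N ⊠ (x , y) ⊛ (x + y , y) ≋ (β , α + β)
  odd-power i x y = ≋-trans (⊛-cong (2^odd-power i x y) ≋-refl) (sym β≈′ , sym α+β≈)
    where
    N = 2 ℕ.^ (1 ℕ.+ 2 ℕ.* i)
    α≈ = +-cong (^[N+1] N x) (^[N+1] N y)
    β≈ = +-cong (^[N+1] N y)
      (trans (^[N+1] N (x + y)) (*-congʳ ([x+y]^p^n (1 ℕ.+ 2 ℕ.* i) x y)))
    β≈′ = trans β≈ (+-comm _ _)
    α+β≈ = begin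
      _ ≈⟨ +-cong α≈ β≈ ⟩
      x ^ N * x + y ^ N * y + (y ^ N * y + (x ^ N + y ^ N) * (x + y))
        ≈⟨ solve 4 (λ X Y x y →
             X :* x :+ Y :* y :+ (Y :* y :+ (X :+ Y) :* (x :+ y))
             := (X :+ Y) :* y :+ Y :* (x :+ y) :+ Y :* y :+ (X :* x) :+ (X :* x))
             refl (x ^ N) (y ^ N) x y ⟩
      (x ^ N + y ^ N) * y + y ^ N * (x + y) + y ^ N * y + x ^ N * x + x ^ N * x
        ≈⟨ x+y+y≈x _ _ ⟩
      (x ^ N + y ^ N) * y + y ^ N * (x + y) + y ^ N * y ∎

  ω = 0# , 1#

  ω²ω≋1 : (1# , 1#) ⊛ ω ≋ (1# , 0#)
  ω²ω≋1 = solve 0 (con 1 :* con 0 :+ con 1 :* con 1 := con 1) refl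
    , trans (solve 0 (con 1 :* con 1 :+ con 1 :* con 0 :+ con 1 :* con 1 := con 1 :+ con 1) refl) (x+x≈0 1#)

  -- As `q` is an odd power of 2, it sends ω² to ω. So x + yω² has q-th power x^q + y^q ω = y + (x +
  -- y)ω, which is ω(x + yω) because ω² = 1 + ω.
  conjugate-^q : ∀ h x y → let q = 2 ℕ.^ (1 ℕ.+ 2 ℕ.* h) in x ^ q ≈ y → y ^ q ≈ x + y →
                 q ⊠ (x + y , y) ≋ ω ⊛ (x , y)
  conjugate-^q h x y x^q≈y y^q≈x+y = ≋-trans (2^odd-power h (x + y) y)
    ( (begin
        (x + y) ^ q + y ^ q     ≈⟨ +-cong ([x+y]^p^n (1 ℕ.+ 2 ℕ.* h) x y) y^q≈x+y ⟩
        x ^ q + y ^ q + (x + y) ≈⟨ +-congʳ (+-cong x^q≈y y^q≈x+y) ⟩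
        y + (x + y) + (x + y)   ≈⟨ x+y+y≈x y (x + y) ⟩
        y                       ≈⟨ solve 2 (λ x y → y := con 0 :* x :+ con 1 :* y) refl x y ⟩
        0# * x + 1# * y         ∎)
    , trans y^q≈x+y (solve 2 (λ x y → x :+ y := con 0 :* y :+ con 1 :* x :+ con 1 :* y) refl x y))
    where
    q = 2 ℕ.^ (1 ℕ.+ 2 ℕ.* h)

  -- Write V for the conjugate of U = x + yω. By ω³ = 1, U^(Nq) U = ω² U^(Nq) (ωU), and ωU = V^q by
  -- `conjugate-^q`; so the power is ω² (U^N V)^q, where `odd-power` gives U^N V. The pair
  -- `(1# , 1#)` is ω².
  odd-odd-power : ∀ i h x y → let N = 2 ℕ.^ (1 ℕ.+ 2 ℕ.* i)
                                  q = 2 ℕ.^ (1 ℕ.+ 2 ℕ.* h)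
                                  α = x ^ (N ℕ.+ 1) + y ^ (N ℕ.+ 1)
                                  β = y ^ (N ℕ.+ 1) + (x + y) ^ (N ℕ.+ 1) in
    x ^ q ≈ y → y ^ q ≈ x + y →
    (N ℕ.* q ℕ.+ 1) ⊠ (x , y) ≋ (1# , 1#) ⊛ (q ⊠ (β , α + β))
  odd-odd-power i h x y x^q≈y y^q≈x+y = ≋R.begin
    (N ℕ.* q ℕ.+ 1) ⊠ U              ≋R.≈⟨ ⊠-homo-+ U (N ℕ.* q) 1 ⟩
    (N ℕ.* q) ⊠ U ⊛ 1 ⊠ U            ≋R.≈⟨ ⊛-cong (≋-trans (⊠-congˡ (ℕ.*-comm N q)) (≋-sym (⊠-assocˡ U q N))) (⊠-homo-1 U) ⟩
    Z ⊛ U                            ≋R.≈⟨ ⊛.identityˡ (Z ⊛ U) ⟨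
    (1# , 0#) ⊛ (Z ⊛ U)              ≋R.≈⟨ ⊛-cong ω²ω≋1 ≋-refl ⟨
    (1# , 1#) ⊛ ω ⊛ (Z ⊛ U)          ≋R.≈⟨ ⊛-assoc (1# , 1#) ω (Z ⊛ U) ⟩
    (1# , 1#) ⊛ (ω ⊛ (Z ⊛ U))        ≋R.≈⟨ ⊛-cong ≋-refl (⊛.x∙yz≈y∙xz ω Z U) ⟩
    (1# , 1#) ⊛ (Z ⊛ (ω ⊛ U))        ≋R.≈⟨ ⊛-cong ≋-refl (⊛-cong ≋-refl (conjugate-^q h x y x^q≈y y^q≈x+y)) ⟨
    (1# , 1#) ⊛ (Z ⊛ q ⊠ (x + y , y)) ≋R.≈⟨ ⊛-cong ≋-refl (⊠-distrib-⊛ (N ⊠ U) (x + y , y) q) ⟨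
    (1# , 1#) ⊛ q ⊠ (N ⊠ U ⊛ (x + y , y)) ≋R.≈⟨ ⊛-cong ≋-refl (⊠-congʳ q (odd-power i x y)) ⟩
    (1# , 1#) ⊛ (q ⊠ _)              ≋R.∎
    where
    module ≋R = SetoidReasoning ≋-setoid
    module ⊛ where
      open CommutativeMonoid ⊛-commutativeMonoid public
      open import Algebra.Properties.CommutativeSemigroup commutativeSemigroup public
    N = 2 ℕ.^ (1 ℕ.+ 2 ℕ.* i)
    q = 2 ℕ.^ (1 ℕ.+ 2 ℕ.* h)
    U = x , y
    Z = q ⊠ (N ⊠ U)

  private
    fixed : ∀ h → (∀ z → z ^ (2 ℕ.^ (2 ℕ.* h)) ≈ z) → ∀ x y → (2 ℕ.^ (2 ℕ.* h)) ⊠ (x , y) ≋ (x , y)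
    fixed h fix x y = ≋-trans (2^even-power h x y) (fix x , fix y)

    -- For odd `k` the exponent 3k is odd, and the 2^(3k)-th power does not act coordinatewise on
    -- pairs; doubling the exponent makes `fixed` applicable.
    fix-twice : ∀ m → (∀ z → z ^ (2 ℕ.^ m) ≈ z) → ∀ z → z ^ (2 ℕ.^ (2 ℕ.* m)) ≈ z
    fix-twice m fix z = begin
      z ^ (2 ℕ.^ (2 ℕ.* m))          ≈⟨ ^-congʳ z (≡.trans (≡.cong (2 ℕ.^_) (≡.cong (m ℕ.+_) (ℕ.+-identityʳ m))) (ℕ.^-distribˡ-+-* 2 m m)) ⟩
      z ^ (2 ℕ.^ m ℕ.* 2 ℕ.^ m)      ≈⟨ ^-assocʳ z (2 ℕ.^ m) (2 ℕ.^ m) ⟨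
      (z ^ (2 ℕ.^ m)) ^ (2 ℕ.^ m)    ≈⟨ ^-congˡ (2 ℕ.^ m) (fix z) ⟩
      z ^ (2 ℕ.^ m)                  ≈⟨ fix z ⟩
      z                              ∎

  -- Let U = (x , y). If `s` is positive, `k` and `ℓ` are both even; if `s` is zero, `k` is odd and
  -- the parity of `ℓ` decides. In each case a power of U with exponent of the form 2^e + 1 is
  -- expressed by the two given sums, and `2^ℓ+1-power-injective` recovers U.
  invariants-determine : ∀ k ℓ s o j → k ≡ 2 ℕ.^ s ℕ.* (1 ℕ.+ 2 ℕ.* o) → ℓ ≡ 2 ℕ.^ s ℕ.* j →
    (∀ z → z ^ (2 ℕ.^ (3 ℕ.* k)) ≈ z) →
    let q = 2 ℕ.^ k
        N = 2 ℕ.^ ℓ ℕ.+ 1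
    in ∀ {x y x′ y′} →
    x ^ q ≈ y → y ^ q ≈ x + y → x′ ^ q ≈ y′ → y′ ^ q ≈ x′ + y′ →
    x ^ N + y ^ N ≈ x′ ^ N + y′ ^ N →
    y ^ N + (x + y) ^ N ≈ y′ ^ N + (x′ + y′) ^ N → x ≈ x′
  invariants-determine .(2 ℕ.^ suc s ℕ.* (1 ℕ.+ 2 ℕ.* o)) .(2 ℕ.^ suc s ℕ.* j) (suc s) o j ≡.refl ≡.refl fix
    {x} {y} {x′} {y′} _ _ _ _ α≈ β≈ =
    proj₁ (2^ℓ+1-power-injective ⊛-commutativeMonoid
      (2 ℕ.* i) (2 ℕ.* h) (1 ℕ.+ 3 ℕ.* o) j (Exponents.even-even (2 ℕ.^ s) o j)
      (fixed h fix′ x y) (fixed h fix′ x′ y′)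
      (≋-trans (even-power i x y) (≋-trans (α≈″ , +-cong α≈″ β≈″) (≋-sym (even-power i x′ y′)))))
    where
    i = 2 ℕ.^ s ℕ.* j
    h = 3 ℕ.* (2 ℕ.^ s ℕ.* (1 ℕ.+ 2 ℕ.* o))
    instance
      _ : NonZero (2 ℕ.* h)
      _ = ℕ.m*n≢0 2 h {{_}} {{ℕ.m*n≢0 3 _ {{_}} {{ℕ.m*n≢0 (2 ℕ.^ s) (1 ℕ.+ 2 ℕ.* o) {{ℕ.m^n≢0 2 s}}}}}}
    ℓ≡2i : 2 ℕ.^ suc s ℕ.* j ≡ 2 ℕ.* i
    ℓ≡2i = ℕ.*-assoc 2 (2 ℕ.^ s) j
    fix′ : ∀ z → z ^ (2 ℕ.^ (2 ℕ.* h)) ≈ z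
    fix′ = ≡.subst (λ e → ∀ z → z ^ (2 ℕ.^ e) ≈ z) (Exponents.3∙2th≡2∙3th (2 ℕ.^ s) (1 ℕ.+ 2 ℕ.* o)) fix
    α≈″ = ≡.subst (λ e → let N = 2 ℕ.^ e ℕ.+ 1 in x ^ N + y ^ N ≈ x′ ^ N + y′ ^ N) ℓ≡2i α≈
    β≈″ = ≡.subst (λ e → let N = 2 ℕ.^ e ℕ.+ 1 in y ^ N + (x + y) ^ N ≈ y′ ^ N + (x′ + y′) ^ N) ℓ≡2i β≈
  invariants-determine k ℓ zero o j k≡ ℓ≡ fix {x} {y} {x′} {y′} x^q≈y y^q≈x+y x′^q≈y′ y′^q≈x′+y′ α≈ β≈
    with ≡.trans k≡ (ℕ.*-identityˡ _) | even⊎odd ℓ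
  ... | ≡.refl | inj₁ (i , ≡.refl) =
    proj₁ (2^ℓ+1-power-injective ⊛-commutativeMonoid
      (2 ℕ.* i) (2 ℕ.* (3 ℕ.* k)) (1 ℕ.+ 3 ℕ.* o) i (Exponents.odd-even o i)
      (fixed (3 ℕ.* k) fix′ x y) (fixed (3 ℕ.* k) fix′ x′ y′)
      (≋-trans (even-power i x y) (≋-trans (α≈ , +-cong α≈ β≈) (≋-sym (even-power i x′ y′)))))
    where
    fix′ = fix-twice (3 ℕ.* k) fix
  -- With `ℓ` and `k` odd the exponent is 2^(ℓ+k) + 1, that is Qq + 1; the sum ℓ + k is even, as the
  -- divisibility by 2·3k requires.
  ... | ≡.refl | inj₂ (i , ≡.refl) =
    proj₁ (2^ℓ+1-power-injective ⊛-commutativeMonoid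
      (ℓ ℕ.+ k) (2 ℕ.* (3 ℕ.* k)) (1 ℕ.+ 3 ℕ.* o) (1 ℕ.+ i ℕ.+ o) (Exponents.odd-odd o i)
      (fixed (3 ℕ.* k) fix′ x y) (fixed (3 ℕ.* k) fix′ x′ y′)
      (≋-trans (power x y x^q≈y y^q≈x+y) (≋-trans
        (⊛-cong ≋-refl (⊠-congʳ (2 ℕ.^ k) (β≈ , +-cong α≈ β≈)))
        (≋-sym (power x′ y′ x′^q≈y′ y′^q≈x′+y′)))))
    where
    fix′ = fix-twice (3 ℕ.* k) fix
    power : ∀ x y → x ^ (2 ℕ.^ k) ≈ y → y ^ (2 ℕ.^ k) ≈ x + y → _
    power x y e e′ = ≋-trans (⊠-congˡ (≡.cong (ℕ._+ 1) (ℕ.^-distribˡ-+-* 2 ℓ k))) (odd-odd-power i o x y e e′)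

-- Polynomial functions and the bound on their roots.

module PolynomialFunctions (K : CommutativeRing a ℓ) where
  open CommutativeRing K hiding (zero)
  open Exp commutativeSemiring
  open SemiringSolver commutativeSemiring using (solve; _:+_; _:*_; _:=_; con)
  open RingProperties ring using (x∙y⁻¹≈ε⇒x≈y)
  open SetoidReasoning setoid

  -- g is a polynomial function of degree less than n, by divided differences:
  -- g x - g r is (x - r) times a polynomial function of degree less than n - 1,
  -- stated without subtraction as a semiring identity.
  Degree< : ℕ → (Carrier → Carrier) → Set (a ⊔ ℓ)
  Degree< zero    g = ∀ x → g x ≈ 0#
  Degree< (suc n) g = ∀ r → ∃[ h ] Degree< n h Prod.× (∀ x → g x + r * h x ≈ g r + x * h x)

  Degree<-0 : ∀ n → Degree< n (λ _ → 0#)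
  Degree<-0 zero    x = refl
  Degree<-0 (suc n) r = (λ _ → 0#) , Degree<-0 n , λ x → +-congˡ (trans (zeroʳ r) (sym (zeroʳ x)))

  Degree<-const : ∀ n c → Degree< (suc n) (λ _ → c)
  Degree<-const n c r = (λ _ → 0#) , Degree<-0 n , λ x → +-congˡ (trans (zeroʳ r) (sym (zeroʳ x)))

  Degree<-+ : ∀ n {g h} → Degree< n g → Degree< n h → Degree< n (λ x → g x + h x)
  Degree<-+ zero    dg dh x = trans (+-cong (dg x) (dh x)) (+-identityʳ 0#)
  Degree<-+ (suc n) {g} {h} dg dh r
    with g′ , dg′ , eg ← dg r | h′ , dh′ , eh ← dh r =
    (λ x → g′ x + h′ x) , Degree<-+ n dg′ dh′ , λ x → begin
      g x + h x + r * (g′ x + h′ x)        ≈⟨ regroup (g x) (h x) r (g′ x) (h′ x) ⟩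
      (g x + r * g′ x) + (h x + r * h′ x)  ≈⟨ +-cong (eg x) (eh x) ⟩
      (g r + x * g′ x) + (h r + x * h′ x)  ≈⟨ regroup (g r) (h r) x (g′ x) (h′ x) ⟨
      g r + h r + x * (g′ x + h′ x)        ∎
    where
    regroup : ∀ a b c d e → a + b + c * (d + e) ≈ (a + c * d) + (b + c * e)
    regroup = solve 5 (λ a b c d e → a :+ b :+ c :* (d :+ e) := (a :+ c :* d) :+ (b :+ c :* e)) refl

  -- If h is the divided difference of g at r, then that of x g(x) is g(r) + x h(x).
  Degree<-x* : ∀ n {g} → Degree< n g → Degree< (suc n) (λ x → x * g x)
  Degree<-x* zero    {g} dg r = (λ _ → 0#) , (λ _ → refl) , λ x → +-cong
    (trans (trans (*-congˡ (dg x)) (zeroʳ x)) (sym (trans (*-congˡ (dg r)) (zeroʳ r))))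
    (trans (zeroʳ r) (sym (zeroʳ x)))
  Degree<-x* (suc n) {g} dg r with h , dh , e ← dg r =
    (λ x → g r + x * h x) , Degree<-+ (suc n) (Degree<-const n (g r)) (Degree<-x* n dh) , λ x → begin
      x * g x + r * (g r + x * h x)       ≈⟨ solve 5 (λ x gx r gr hx → x :* gx :+ r :* (gr :+ x :* hx) := r :* gr :+ x :* (gx :+ r :* hx)) refl x (g x) r (g r) (h x) ⟩
      r * g r + x * (g x + r * h x)       ≈⟨ +-congˡ (*-congˡ (e x)) ⟩
      r * g r + x * (g r + x * h x)       ∎

  Degree<-^ : ∀ n → Degree< (suc n) (_^ n)
  Degree<-^ zero    = Degree<-const 0 1#
  Degree<-^ (suc n) = Degree<-x* (suc n) (Degree<-^ n)

  module _ (cancel : ∀ {x y} → x * y ≈ 0# → ¬ (x ≈ 0#) → y ≈ 0#) where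

    -- At the root `t zero` the function is (x - t₀) h(x); by `cancel` the remaining roots are roots
    -- of h, which has smaller degree and so vanishes by induction.
    Degree<-roots : ∀ n {g} → Degree< n g → (t : Fin n → Carrier) → Injective _≡_ _≈_ t →
                    (∀ i → g (t i) ≈ 0#) → ∀ x → g x ≈ 0#
    Degree<-roots zero    dg t inj roots x = dg x
    Degree<-roots (suc n) {g} dg t inj roots x with h , dh , e ← dg (t zero) = begin
      g x                     ≈⟨ +-identityʳ (g x) ⟨
      g x + 0#                ≈⟨ +-congˡ (trans (*-congˡ (h≈0 x)) (zeroʳ (t zero))) ⟨
      g x + t zero * h x      ≈⟨ e x ⟩
      g (t zero) + x * h x    ≈⟨ +-cong (roots zero) (trans (*-congˡ (h≈0 x)) (zeroʳ x)) ⟩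
      0# + 0#                 ≈⟨ +-identityʳ 0# ⟩
      0#                      ∎
      where
      h≈0 : ∀ x → h x ≈ 0#
      h≈0 = Degree<-roots n dh (t ∘ suc) (Fin.suc-injective ∘ inj) λ i →
        cancel (begin
          (t (suc i) - t zero) * h (t (suc i))                  ≈⟨ distribʳ _ _ _ ⟩
          t (suc i) * h (t (suc i)) + - t zero * h (t (suc i))  ≈⟨ +-congʳ (+-identityˡ _) ⟨
          0# + t (suc i) * h (t (suc i)) + - t zero * h (t (suc i)) ≈⟨ +-congʳ (+-congʳ (roots zero)) ⟨
          g (t zero) + t (suc i) * h (t (suc i)) + - t zero * h (t (suc i)) ≈⟨ +-congʳ (e (t (suc i))) ⟨
          g (t (suc i)) + t zero * h (t (suc i)) + - t zero * h (t (suc i)) ≈⟨ +-congʳ (trans (+-congʳ (roots (suc i))) (+-identityˡ _)) ⟩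
          t zero * h (t (suc i)) + - t zero * h (t (suc i))     ≈⟨ distribʳ _ _ _ ⟨
          (t zero - t zero) * h (t (suc i))                     ≈⟨ *-congʳ (-‿inverseʳ (t zero)) ⟩
          0# * h (t (suc i))                                    ≈⟨ zeroˡ _ ⟩
          0#                                                    ∎)
        λ d → contradiction (inj (x∙y⁻¹≈ε⇒x≈y _ _ d)) λ ()

-- Finite sets: injective self-maps, search, and reindexing of sums.

Fin-injective⇒surjective : ∀ {n} {f : Fin n → Fin n} → Injective _≡_ _≡_ f → ∀ j → ∃[ i ] f i ≡ j
Fin-injective⇒surjective {suc n} {f} inj j with any? (λ i → f i Fin.≟ j)
... | yes ∃i = ∃i
-- If `j` is missed, punching it out of the codomain gives an injection into a smaller finite set.
... | no  ∄i = contradiction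
  (λ {i} {i′} e → inj (punchOut-injective (j≢f i) (j≢f i′) e))
  (Fin.<⇒notInjective (ℕ.n<1+n n))
  where
  j≢f : ∀ i → j ≢ f i
  j≢f i e = ∄i (i , ≡.sym e)

module FiniteSetoid (S : Setoid a ℓ) {n : ℕ} (card : HasCardinality S n) where
  open Setoid S
  open Inverse card renaming (to to index; from to element)

  element-index : ∀ x → element (index x) ≈ x
  element-index x = inverseʳ ≡.refl

  index-element : ∀ i → index (element i) ≡ i
  index-element i = inverseˡ refl

  index-injective : ∀ {x y} → index x ≡ index y → x ≈ y
  index-injective {x} {y} eq = trans (sym (element-index x)) (trans (from-cong eq) (element-index y))

  element-injective : Injective _≡_ _≈_ element
  element-injective {i} {j} eq = ≡.trans (≡.sym (index-element i)) (≡.trans (to-cong eq) (index-element j))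

  infix 4 _≟_
  _≟_ : ∀ x y → Dec (x ≈ y)
  x ≟ y = Dec.map′ index-injective to-cong (index x Fin.≟ index y)

  anyElement? : ∀ {p} {P : Carrier → Set p} → (∀ x → Dec (P x)) → (∀ {x y} → x ≈ y → P x → P y) → Dec (∃ P)
  anyElement? P? resp = Dec.map′ (λ (i , p) → element i , p)
    (λ (x , p) → index x , resp (sym (element-index x)) p) (any? (P? ∘ element))

  injective⇒bijective : ∀ {f : Carrier → Carrier} → Congruent _≈_ _≈_ f → Injective _≈_ _≈_ f → Bijective _≈_ _≈_ f
  injective⇒bijective {f} f-cong inj = inj , λ y →
    let i , e = Fin-injective⇒surjective (λ e → element-injective (inj (index-injective e))) (index y)
    in element i , λ z≈x → trans (f-cong z≈x) (index-injective e)

  module _ {b ℓ′} (M : CommutativeMonoid b ℓ′) where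
    private module M = CommutativeMonoid M
    open CommutativeMonoidSum M using (sum; sum-permute; sum-cong-≋)

    -- The mutually inverse maps φ and ψ become a permutation of the indices. It is applied to
    -- translation by 1 in the additive monoid and to scaling by a unit in the multiplicative one.
    sum-reindex : ∀ {h : Carrier → M.Carrier} → (∀ {x y} → x ≈ y → h x M.≈ h y) →
                  {φ ψ : Carrier → Carrier} → Congruent _≈_ _≈_ φ → Congruent _≈_ _≈_ ψ →
                  (∀ x → φ (ψ x) ≈ x) → (∀ x → ψ (φ x) ≈ x) →
                  sum (h ∘ element) M.≈ sum (h ∘ φ ∘ element)
    sum-reindex {h} h-cong {φ} {ψ} φ-cong ψ-cong φψ ψφ =
      M.trans (sum-permute (h ∘ element) π) (sum-cong-≋ λ i → h-cong (element-index (φ (element i))))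
      where
      π : Perm.Permutation n n
      π = Perm.permutation (index ∘ φ ∘ element) (index ∘ ψ ∘ element)
        (λ i → ≡.trans (to-cong (trans (φ-cong (element-index _)) (φψ _))) (index-element i))
        (λ i → ≡.trans (to-cong (trans (ψ-cong (element-index _)) (ψφ _))) (index-element i))

-- Finite fields: inverses, characteristic, Fermat's theorem.

module FiniteField (F : HeytingField a ℓ₁ ℓ₂) where
  private
    K : CommutativeRing _ _
    K = HeytingCommutativeRing.commutativeRing (HeytingField.heytingCommutativeRing F)

  open CommutativeRing K hiding (zero)
  open Exp commutativeSemiring
  open SemiringMult semiring using (_×_)
  open RingProperties ring using (+-identityˡ-unique)
  open PolynomialFunctions K
  open SetoidReasoning setoid

  module _ {n : ℕ} (card : HasCardinality setoid n) where
    open FiniteSetoid setoid card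
    open Inverse card using () renaming (from to element)

    -- In a finite field, where the existence of an inverse is decidable, _≉_ implies _#_.
    inverse : ∀ {x} → x ≉ 0# → ∃[ y ] x * y ≈ 1#
    inverse {x} x≉0 with anyElement? (λ y → x * y ≟ 1#) (λ y≈z e → trans (*-congˡ (sym y≈z)) e)
    ... | yes inv = inv
    ... | no ∄inv = contradiction (proj₁ (HeytingField.tight F x 0#) λ x#0 → ∄inv (inv x#0)) x≉0
      where
      inv : HeytingField._#_ F x 0# → ∃[ y ] x * y ≈ 1#
      inv x#0 with y , _ , e ← HeytingField.#⇒invertible F x#0 =
        y , trans (*-congʳ (sym (trans (+-congˡ -0#≈0#) (+-identityʳ x)))) e
        where open RingProperties ring using (-0#≈0#)

    cancel : ∀ {x y} → x * y ≈ 0# → x ≉ 0# → y ≈ 0#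
    cancel {x} {y} xy≈0 x≉0 with z , xz≈1 ← inverse x≉0 = begin
      y            ≈⟨ *-identityˡ y ⟨
      1# * y       ≈⟨ *-congʳ (trans (*-comm z x) xz≈1) ⟨
      z * x * y    ≈⟨ *-assoc z x y ⟩
      z * (x * y)  ≈⟨ *-congˡ xy≈0 ⟩
      z * 0#       ≈⟨ zeroʳ z ⟩
      0#           ∎

    *-≉0 : ∀ {x y} → x ≉ 0# → y ≉ 0# → x * y ≉ 0#
    *-≉0 x≉0 y≉0 xy≈0 = y≉0 (cancel xy≈0 x≉0)

    *-cancelˡ : ∀ {x y z} → x ≉ 0# → x * y ≈ x * z → y ≈ z
    *-cancelˡ {x} {y} {z} x≉0 e = x∙y⁻¹≈ε⇒x≈y y z (cancel (begin
      x * (y - z)     ≈⟨ x[y-z]≈xy-xz x y z ⟩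
      x * y - x * z   ≈⟨ +-congʳ e ⟩
      x * z - x * z   ≈⟨ -‿inverseʳ (x * z) ⟩
      0#              ∎) x≉0)
      where open RingProperties ring using (x∙y⁻¹≈ε⇒x≈y; x[y-z]≈xy-xz)

    ^-≉0 : ∀ {x} → 1# ≉ 0# → x ≉ 0# → ∀ m → x ^ m ≉ 0#
    ^-≉0 1≉0 x≉0 zero    = 1≉0
    ^-≉0 1≉0 x≉0 (suc m) = *-≉0 x≉0 (^-≉0 1≉0 x≉0 m)

    ^≈0⇒≈0 : ∀ {x} → 1# ≉ 0# → ∀ m → x ^ m ≈ 0# → x ≈ 0#
    ^≈0⇒≈0 {x} 1≉0 m e with x ≟ 0#
    ... | yes x≈0 = x≈0
    ... | no  x≉0 = contradiction e (^-≉0 1≉0 x≉0 m)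

    -- Translation by 1 permutes the summands of the sum of all elements.
    n×1≈0 : n × 1# ≈ 0#
    n×1≈0 = +-identityˡ-unique (n × 1#) (sum element) (begin
      n × 1# + sum element                ≈⟨ +-congʳ (sum-replicate n) ⟨
      sum {n} (λ _ → 1#) + sum element        ≈⟨ ∑-distrib-+ {n} (λ _ → 1#) element ⟨
      sum (λ i → 1# + element i)          ≈⟨ sum-reindex +-commutativeMonoid (λ e → e) +-congˡ +-congˡ
                                              (λ x → trans (sym (+-assoc _ _ _)) (trans (+-congʳ (-‿inverseʳ 1#)) (+-identityˡ x)))
                                              (λ x → trans (sym (+-assoc _ _ _)) (trans (+-congʳ (-‿inverseˡ 1#)) (+-identityˡ x))) ⟨
      sum element                         ∎)
      where open CommutativeMonoidSum +-commutativeMonoid using (sum; sum-replicate; ∑-distrib-+)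

  module _ {m : ℕ} (card : HasCardinality setoid (suc m)) where
    open FiniteSetoid setoid card
    open Inverse card using (to-cong) renaming (to to index; from to element)
    open CommutativeMonoidSum *-commutativeMonoid
      using (sum-replicate; sum-remove; sum-cong-≋)
      renaming (sum to product; ∑-distrib-+ to ∏-distrib-*)

    nonzero : Fin m → Carrier
    nonzero = removeAt element (index 0#)

    nonzero≉0 : ∀ i → nonzero i ≉ 0#
    nonzero≉0 i e = punchInᵢ≢i (index 0#) i
      (≡.trans (≡.sym (index-element _)) (to-cong e))

    nonzero-injective : Injective _≡_ _≈_ nonzero
    nonzero-injective e = punchIn-injective (index 0#) _ _ (element-injective e)

    -- Multiplication by x permutes the factors of the product of all nonzero elements.
    ^-card-1 : 1# ≉ 0# → ∀ {x} → x ≉ 0# → x ^ m ≈ 1#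
    ^-card-1 1≉0 {x} x≉0 with y , xy≈1 ← inverse card x≉0 = *-cancelˡ card P≉0 (begin
      P * x ^ m                                  ≈⟨ *-comm P (x ^ m) ⟩
      x ^ m * P                                  ≈⟨ *-congʳ (sum-replicate m) ⟨
      product {m} (λ _ → x) * P                  ≈⟨ ∏-distrib-* {m} (λ _ → x) nonzero ⟨
      product (λ i → x * nonzero i)              ≈⟨ sum-cong-≋ (λ i → h-nonzero (*-≉0 card x≉0 (nonzero≉0 i))) ⟨
      product (removeAt (h ∘ (x *_) ∘ element) (index 0#))
        ≈⟨ remove-zero (h ∘ (x *_) ∘ element) (h-zero (trans (*-congˡ (element-index 0#)) (zeroʳ x))) ⟨
      product (h ∘ (x *_) ∘ element)             ≈⟨ sum-reindex *-commutativeMonoid h-cong *-congˡ *-congˡ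
                                                     (λ z → trans (sym (*-assoc _ _ _)) (trans (*-congʳ xy≈1) (*-identityˡ z)))
                                                     (λ z → trans (sym (*-assoc _ _ _)) (trans (*-congʳ (trans (*-comm y x) xy≈1)) (*-identityˡ z))) ⟨
      product (h ∘ element)                      ≈⟨ remove-zero (h ∘ element) (h-zero (element-index 0#)) ⟩
      product (removeAt (h ∘ element) (index 0#)) ≈⟨ sum-cong-≋ (λ i → h-nonzero (nonzero≉0 i)) ⟩
      P                                          ≈⟨ *-identityʳ P ⟨
      P * 1#                                     ∎)
      where
      P = product nonzero
      product-≉0 : ∀ {k} (t : Fin k → Carrier) → (∀ i → t i ≉ 0#) → product t ≉ 0#
      product-≉0 {zero}  t t≉0 = 1≉0
      product-≉0 {suc k} t t≉0 = *-≉0 card (t≉0 zero) (product-≉0 (t ∘ suc) (t≉0 ∘ suc))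
      P≉0 : P ≉ 0#
      P≉0 = product-≉0 nonzero nonzero≉0
      -- Replacing 0 by 1 turns the product of the nonzero elements into one over all elements, to
      -- which `sum-reindex` applies.
      h : Carrier → Carrier
      h z with z ≟ 0#
      ... | yes _ = 1#
      ... | no  _ = z
      h-zero : ∀ {z} → z ≈ 0# → h z ≈ 1#
      h-zero {z} e with z ≟ 0#
      ... | yes _  = refl
      ... | no z≉0 = contradiction e z≉0
      h-nonzero : ∀ {z} → z ≉ 0# → h z ≈ z
      h-nonzero {z} ne with z ≟ 0#
      ... | yes z≈0 = contradiction z≈0 ne
      ... | no _    = refl
      h-cong : ∀ {z w} → z ≈ w → h z ≈ h w
      h-cong {z} {w} e with z ≟ 0# | w ≟ 0#
      ... | yes _   | yes _   = refl
      ... | yes z≈0 | no w≉0  = contradiction (trans (sym e) z≈0) w≉0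
      ... | no z≉0  | yes w≈0 = contradiction (trans e w≈0) z≉0
      ... | no _    | no _    = e
      remove-zero : ∀ t → t (index 0#) ≈ 1# → product t ≈ product (removeAt t (index 0#))
      remove-zero t e = trans (sum-remove t) (trans (*-congʳ e) (*-identityˡ _))

    fermat : 1# ≉ 0# → ∀ x → x ^ suc m ≈ x
    fermat 1≉0 x with x ≟ 0#
    ... | yes x≈0 = trans (trans (*-congʳ x≈0) (zeroˡ (x ^ m))) (sym x≈0)
    ... | no  x≉0 = trans (*-congˡ (^-card-1 1≉0 x≉0)) (*-identityʳ x)

    -- Otherwise X^k - 1 would vanish on the m nonzero elements, hence at 0.
    ∃-^≉1 : 1# ≉ 0# → ∀ k → 0 ℕ.< k → k ℕ.< m → ∃[ w ] w ≉ 0# Prod.× w ^ k ≉ 1#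
    ∃-^≉1 1≉0 k@(suc _) _ k<m with anyElement? (λ w → ¬? (w ≟ 0#) ×-dec ¬? (w ^ k ≟ 1#))
        (λ x≈y (p , q) → (λ e → p (trans x≈y e)) , λ e → q (trans (^-congˡ k x≈y) e))
    ... | yes ∃w = ∃w
    ... | no  ∄w = contradiction (begin
        1#                 ≈⟨ -‿involutive 1# ⟨
        - - 1#             ≈⟨ -‿cong (trans (sym (trans (+-congʳ (zeroˡ _)) (+-identityˡ _))) vanishes) ⟩
        - 0#               ≈⟨ -0#≈0# ⟩
        0#                 ∎) 1≉0
      where
      open RingProperties ring using (-0#≈0#; -‿involutive)
      vanishes : 0# ^ k + - 1# ≈ 0#
      vanishes = Degree<-roots (cancel card) (suc k) (Degree<-+ (suc k) (Degree<-^ k) (Degree<-const k (- 1#)))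
        (nonzero ∘ λ i → inject≤ i k<m)
        (λ e → inject≤-injective k<m k<m _ _ (nonzero-injective e))
        (λ i → let w = nonzero (inject≤ i k<m) in
          trans (+-congʳ (decidable-stable (w ^ k ≟ 1#) λ ne → ∄w (w , nonzero≉0 _ , ne))) (-‿inverseʳ 1#))
        0#

-- Evaluation of polynomials as a ring homomorphism.

module PolynomialEvaluation (K : CommutativeRing a ℓ) where
  open CommutativeRing K hiding (zero)
  open Exp commutativeSemiring
  open SemiringSolver commutativeSemiring using (solve; _:+_; _:*_; _:=_; con)
  open RingProperties ring using (-0#≈0#; -‿+-comm; -‿distribʳ-*)
  open Polynomial K
  open SetoidReasoning setoid
  private
    module P where
      open RawRing polyRawRing public
      open RawSemiringDefs rawSemiring public using (_^_)

  eval-cong : ∀ u {x y} → x ≈ y → eval u x ≈ eval u y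
  eval-cong []      e = refl
  eval-cong (c ∷ u) e = +-congˡ (*-cong e (eval-cong u e))

  eval-+ : ∀ u v x → eval (u P.+ v) x ≈ eval u x + eval v x
  eval-+ []      v       x = sym (+-identityˡ _)
  eval-+ (c ∷ u) []      x = sym (+-identityʳ _)
  eval-+ (c ∷ u) (d ∷ v) x = begin
    c + d + x * eval (u P.+ v) x            ≈⟨ +-congˡ (*-congˡ (eval-+ u v x)) ⟩
    c + d + x * (eval u x + eval v x)       ≈⟨ solve 5 (λ c d x u v → c :+ d :+ x :* (u :+ v) := c :+ x :* u :+ (d :+ x :* v)) refl c d x (eval u x) (eval v x) ⟩
    c + x * eval u x + (d + x * eval v x)   ∎

  eval-scale : ∀ c u x → eval (map (c *_) u) x ≈ c * eval u x
  eval-scale c []      x = sym (zeroʳ c)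
  eval-scale c (d ∷ u) x = begin
    c * d + x * eval (map (c *_) u) x   ≈⟨ +-congˡ (*-congˡ (eval-scale c u x)) ⟩
    c * d + x * (c * eval u x)          ≈⟨ solve 4 (λ c d x u → c :* d :+ x :* (c :* u) := c :* (d :+ x :* u)) refl c d x (eval u x) ⟩
    c * (d + x * eval u x)              ∎

  eval-* : ∀ u v x → eval (u P.* v) x ≈ eval u x * eval v x
  eval-* []      v x = sym (zeroˡ _)
  eval-* (c ∷ u) v x = begin
    eval (map (c *_) v P.+ (0# ∷ u P.* v)) x             ≈⟨ eval-+ (map (c *_) v) _ x ⟩
    eval (map (c *_) v) x + (0# + x * eval (u P.* v) x)  ≈⟨ +-cong (eval-scale c v x) (+-congˡ (*-congˡ (eval-* u v x))) ⟩
    c * eval v x + (0# + x * (eval u x * eval v x))      ≈⟨ solve 4 (λ c v x u → c :* v :+ (con 0 :+ x :* (u :* v)) := (c :+ x :* u) :* v) refl c (eval v x) x (eval u x) ⟩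
    (c + x * eval u x) * eval v x                        ∎

  eval-neg : ∀ u x → eval (P.- u) x ≈ - eval u x
  eval-neg []      x = sym -0#≈0#
  eval-neg (c ∷ u) x = begin
    - c + x * eval (P.- u) x   ≈⟨ +-congˡ (*-congˡ (eval-neg u x)) ⟩
    - c + x * - eval u x       ≈⟨ +-congˡ (-‿distribʳ-* x (eval u x)) ⟨
    - c + - (x * eval u x)     ≈⟨ -‿+-comm c (x * eval u x) ⟩
    - (c + x * eval u x)       ∎

  eval-C : ∀ c x → eval (C c) x ≈ c
  eval-C c x = trans (+-congˡ (zeroʳ x)) (+-identityʳ c)

  eval-X : ∀ x → eval X x ≈ x
  eval-X = solve 1 (λ x → con 0 :+ x :* (con 1 :+ x :* con 0) := x) refl

  eval-^ : ∀ u n x → eval (u P.^ n) x ≈ eval u x ^ n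
  eval-^ u zero    x = eval-C 1# x
  eval-^ u (suc n) x = trans (eval-* u (u P.^ n) x) (*-congˡ (eval-^ u n x))

  eval-X^ : ∀ n x → eval (X P.^ n) x ≈ x ^ n
  eval-X^ n x = trans (eval-^ X n x) (^-congˡ n (eval-X x))

  eval-C*X^ : ∀ c n x → eval (C c P.* X P.^ n) x ≈ c * x ^ n
  eval-C*X^ c n x = trans (eval-* (C c) (X P.^ n) x) (*-cong (eval-C c x) (eval-X^ n x))

  1^n≈1 : ∀ n → 1# ^ n ≈ 1#
  1^n≈1 zero    = refl
  1^n≈1 (suc n) = trans (*-identityˡ _) (1^n≈1 n)

  [x^m]^n≈[x^n]^m : ∀ x m n → (x ^ m) ^ n ≈ (x ^ n) ^ m
  [x^m]^n≈[x^n]^m x m n = trans (^-assocʳ x m n)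
    (trans (^-congʳ x (ℕ.*-comm m n)) (sym (^-assocʳ x n m)))

-- The field with q³ elements, its Frobenius map and its trace.

module CubicTrace {p : ℕ} (pr : Prime p) (k ℓ m : ℕ) (k>0 : k ℕ.> 0)
  (F : HeytingField a ℓ₁ ℓ₂)
  (card : HasCardinality (CubicExtension.fieldSetoid F (p ℕ.^ k)) ((p ℕ.^ k) ℕ.^ 3)) where

  private
    q = p ℕ.^ k
    Q = p ℕ.^ ℓ
    R = p ℕ.^ m

    K : CommutativeRing _ _
    K = HeytingCommutativeRing.commutativeRing (HeytingField.heytingCommutativeRing F)

  open CubicExtension F q using (fieldSetoid; f; Tr; eval; Permutes)
  open CommutativeRing K hiding (zero)
  open Exp commutativeSemiring
  open SemiringMult semiring using (_×_; ×-congˡ; ×-homo-1; ×1-homo-*)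
  open SemiringSolver commutativeSemiring using (solve; _:+_; _:*_; _:=_)
  open FiniteField F
  open PolynomialEvaluation K
  open RingProperties ring using (x∙y⁻¹≈ε⇒x≈y; -‿distribʳ-*)
  open SetoidReasoning setoid

  private
    instance
      _ : NonZero p
      _ = prime⇒nonZero pr

      _ : NonZero (q ℕ.^ 3)
      _ = ℕ.m^n≢0 q 3 {{ℕ.m^n≢0 p k}}

    q>1 : 1 ℕ.< q
    q>1 = ℕ.<-≤-trans (ℕ.nonTrivial⇒n>1 p {{prime⇒nonTrivial pr}})
      (≡.subst (ℕ._≤ q) (ℕ.^-identityʳ p) (ℕ.^-monoʳ-≤ p k>0))

    q<q³ : q ℕ.< q ℕ.^ 3
    q<q³ = ≡.subst (ℕ._< q ℕ.^ 3) (ℕ.^-identityʳ q) (ℕ.^-monoʳ-< q q>1 {1} {3} (s≤s (s≤s z≤n)))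

    card′ : HasCardinality fieldSetoid (suc (q ℕ.^ 3 ℕ.∸ 1))
    card′ = ≡.subst (HasCardinality fieldSetoid) (≡.sym (ℕ.suc-pred (q ℕ.^ 3))) card

  -- If 1 = 0 then all elements are equal, whereas q³ > 1.
  1≉0 : 1# ≉ 0#
  1≉0 1≈0 = distinct card (ℕ.<-trans q>1 q<q³)
    where
    all-equal : ∀ x y → x ≈ y
    all-equal x y = trans (sym (≈0 x)) (≈0 y)
      where
      ≈0 : ∀ z → 0# ≈ z
      ≈0 z = trans (sym (zeroˡ z)) (trans (*-congʳ (sym 1≈0)) (*-identityˡ z))
    distinct : ∀ {n} → HasCardinality fieldSetoid n → ¬ (1 ℕ.< n)
    distinct {suc zero} _ (s≤s ())
    distinct {suc (suc n)} c _ with () ← FiniteSetoid.element-injective setoid c {zero} {suc zero} (all-equal _ _)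

  -- The power (p·1)^(3k) equals q³·1 = 0, and a field has no nonzero nilpotents.
  p×1≈0 : p × 1# ≈ 0#
  p×1≈0 = ^≈0⇒≈0 card 1≉0 (k ℕ.* 3) (begin
    (p × 1#) ^ (k ℕ.* 3)    ≈⟨ p^n×1 (k ℕ.* 3) ⟨
    (p ℕ.^ (k ℕ.* 3)) × 1#  ≈⟨ ×-congˡ (ℕ.^-*-assoc p k 3) ⟨
    (q ℕ.^ 3) × 1#          ≈⟨ n×1≈0 card ⟩
    0#                      ∎)
    where
    p^n×1 : ∀ n → (p ℕ.^ n) × 1# ≈ (p × 1#) ^ n
    p^n×1 zero    = ×-homo-1 1#
    p^n×1 (suc n) = trans (×1-homo-* p (p ℕ.^ n)) (*-congˡ (p^n×1 n))

  open Frobenius K pr p×1≈0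

  x^q³≈x : ∀ x → x ^ (q ℕ.^ 3) ≈ x
  x^q³≈x x = trans (^-congʳ x (≡.sym (ℕ.suc-pred (q ℕ.^ 3)))) (fermat card′ 1≉0 x)

  x^q² : ∀ x → x ^ (q ℕ.^ 2) ≈ (x ^ q) ^ q
  x^q² x = trans (^-congʳ x (≡.cong (q ℕ.*_) (ℕ.*-identityʳ q))) (sym (^-assocʳ x q q))

  ^q-+ : ∀ x y → (x + y) ^ q ≈ x ^ q + y ^ q
  ^q-+ = [x+y]^p^n k

  Tr-cong : ∀ {x y} → x ≈ y → Tr x ≈ Tr y
  Tr-cong e = +-cong (+-cong (^-congˡ (q ℕ.^ 2) e) (^-congˡ q e)) e

  Tr-iterated : ∀ x → Tr x ≈ (x ^ q) ^ q + x ^ q + x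
  Tr-iterated x = +-congʳ (+-congʳ (x^q² x))

  Tr-+ : ∀ x y → Tr (x + y) ≈ Tr x + Tr y
  Tr-+ x y = begin
    Tr (x + y)                                              ≈⟨ Tr-iterated (x + y) ⟩
    ((x + y) ^ q) ^ q + (x + y) ^ q + (x + y)               ≈⟨ +-congʳ (+-cong (trans (^-congˡ q (^q-+ x y)) (^q-+ _ _)) (^q-+ x y)) ⟩
    (x ^ q) ^ q + (y ^ q) ^ q + (x ^ q + y ^ q) + (x + y)   ≈⟨ solve 6 (λ a b c d e f → a :+ b :+ (c :+ d) :+ (e :+ f) := a :+ c :+ e :+ (b :+ d :+ f)) refl _ _ _ _ x y ⟩
    (x ^ q) ^ q + x ^ q + x + ((y ^ q) ^ q + y ^ q + y)     ≈⟨ +-cong (Tr-iterated x) (Tr-iterated y) ⟨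
    Tr x + Tr y                                             ∎

  Tr-* : ∀ {s} → s ^ q ≈ s → ∀ x → Tr (s * x) ≈ s * Tr x
  Tr-* {s} s^q≈s x = begin
    Tr (s * x)                                    ≈⟨ Tr-iterated (s * x) ⟩
    ((s * x) ^ q) ^ q + (s * x) ^ q + s * x       ≈⟨ +-congʳ (+-cong (trans (^-congˡ q (^q-* x)) (^q-* (x ^ q))) (^q-* x)) ⟩
    s * (x ^ q) ^ q + s * x ^ q + s * x           ≈⟨ solve 4 (λ s a b c → s :* a :+ s :* b :+ s :* c := s :* (a :+ b :+ c)) refl s _ _ x ⟩
    s * ((x ^ q) ^ q + x ^ q + x)                 ≈⟨ *-congˡ (Tr-iterated x) ⟨
    s * Tr x                                      ∎
    where
    ^q-* : ∀ x → (s * x) ^ q ≈ s * x ^ q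
    ^q-* x = trans (^-distrib-* s x q) (*-congʳ s^q≈s)

  [x^q^q]^q≈x : ∀ x → ((x ^ q) ^ q) ^ q ≈ x
  [x^q^q]^q≈x x = begin
    ((x ^ q) ^ q) ^ q          ≈⟨ ^-congˡ q (x^q² x) ⟨
    (x ^ (q ℕ.^ 2)) ^ q        ≈⟨ ^-assocʳ x (q ℕ.^ 2) q ⟩
    x ^ (q ℕ.^ 2 ℕ.* q)        ≈⟨ ^-congʳ x (ℕ.*-comm (q ℕ.^ 2) q) ⟩
    x ^ (q ℕ.^ 3)              ≈⟨ x^q³≈x x ⟩
    x                          ∎

  -- The q-th power permutes the three summands cyclically, because x^(q³) = x.
  Tr^q≈Tr : ∀ x → Tr x ^ q ≈ Tr x
  Tr^q≈Tr x = begin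
    Tr x ^ q                                      ≈⟨ ^-congˡ q (Tr-iterated x) ⟩
    ((x ^ q) ^ q + x ^ q + x) ^ q                 ≈⟨ trans (^q-+ _ x) (+-congʳ (^q-+ _ _)) ⟩
    ((x ^ q) ^ q) ^ q + (x ^ q) ^ q + x ^ q       ≈⟨ +-congʳ (+-congʳ ([x^q^q]^q≈x x)) ⟩
    x + (x ^ q) ^ q + x ^ q                       ≈⟨ solve 3 (λ a b c → a :+ b :+ c := b :+ c :+ a) refl _ _ _ ⟩
    (x ^ q) ^ q + x ^ q + x                       ≈⟨ Tr-iterated x ⟨
    Tr x                                          ∎

  -- The function induced by f, and necessity of both conditions.

  ∂ : Carrier → Carrier
  ∂ x = x ^ q - x

  module _ (c : Carrier) where
    -- Since c^n x^(nR) = (c x^R)^n, the last three terms of f are the conjugates of c x^R.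
    eval-f : ∀ x → eval (f Q R c) x ≈ ∂ x ^ (Q ℕ.+ 1) + Tr (c * x ^ R)
    eval-f x = begin
      eval (f Q R c) x
        ≈⟨ eval-+ (f₁ P.+ f₂ P.+ f₃) f₄ x ⟩
      eval (f₁ P.+ f₂ P.+ f₃) x + eval f₄ x
        ≈⟨ +-congʳ (trans (eval-+ (f₁ P.+ f₂) f₃ x) (+-congʳ (eval-+ f₁ f₂ x))) ⟩
      eval f₁ x + eval f₂ x + eval f₃ x + eval f₄ x
        ≈⟨ +-cong (+-cong (+-cong eval-f₁ (twist (q ℕ.^ 2))) (twist q)) (eval-C*X^ c R x) ⟩
      ∂ x ^ (Q ℕ.+ 1) + z ^ (q ℕ.^ 2) + z ^ q + z
        ≈⟨ solve 4 (λ a b c d → a :+ b :+ c :+ d := a :+ (b :+ c :+ d)) refl _ _ _ z ⟩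
      ∂ x ^ (Q ℕ.+ 1) + Tr z ∎
      where
      open CubicExtension F q using (C; X; polyRawRing)
      module P where
        open RawRing polyRawRing public
        open RawSemiringDefs rawSemiring public using (_^_)
      z = c * x ^ R
      f₁ = (X P.^ q P.+ P.- X) P.^ (Q ℕ.+ 1)
      f₂ = C (c ^ (q ℕ.^ 2)) P.* X P.^ (q ℕ.^ 2 ℕ.* R)
      f₃ = C (c ^ q) P.* X P.^ (q ℕ.* R)
      f₄ = C c P.* X P.^ R
      eval-f₁ : eval f₁ x ≈ ∂ x ^ (Q ℕ.+ 1)
      eval-f₁ = trans (eval-^ (X P.^ q P.+ P.- X) (Q ℕ.+ 1) x) (^-congˡ (Q ℕ.+ 1)
        (trans (eval-+ (X P.^ q) (P.- X) x)
          (+-cong (eval-X^ q x) (trans (eval-neg X x) (-‿cong (eval-X x))))))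
      twist : ∀ n → eval (C (c ^ n) P.* X P.^ (n ℕ.* R)) x ≈ z ^ n
      twist n = begin
        eval (C (c ^ n) P.* X P.^ (n ℕ.* R)) x   ≈⟨ eval-C*X^ (c ^ n) (n ℕ.* R) x ⟩
        c ^ n * x ^ (n ℕ.* R)                    ≈⟨ *-congˡ (^-congʳ x (ℕ.*-comm n R)) ⟩
        c ^ n * x ^ (R ℕ.* n)                    ≈⟨ *-congˡ (^-assocʳ x R n) ⟨
        c ^ n * (x ^ R) ^ n                      ≈⟨ ^-distrib-* c (x ^ R) n ⟨
        z ^ n                                    ∎

    ^R-+ : ∀ x y → (x + y) ^ R ≈ x ^ R + y ^ R
    ^R-+ = [x+y]^p^n m

    ∂-cong : ∀ {x y} → x ≈ y → ∂ x ≈ ∂ y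
    ∂-cong e = +-cong (^-congˡ q e) (-‿cong e)

    ^q-fixed⇒∂≈0 : ∀ {a} → a ^ q ≈ a → ∂ a ≈ 0#
    ^q-fixed⇒∂≈0 {a} a^q≈a = trans (+-congʳ a^q≈a) (-‿inverseʳ a)

    ^q-fixed-^ : ∀ {a} n → a ^ q ≈ a → (a ^ n) ^ q ≈ a ^ n
    ^q-fixed-^ {a} n e = trans ([x^m]^n≈[x^n]^m a n q) (^-congˡ n e)

    ∂-affine : ∀ {u a} → u ^ q ≈ u → a ^ q ≈ a → ∀ x → ∂ (u * x + a) ≈ u * ∂ x
    ∂-affine {u} {a} u^q≈u a^q≈a x = begin
      (u * x + a) ^ q - (u * x + a)             ≈⟨ +-cong (trans (^q-+ (u * x) a) (+-cong (trans (^-distrib-* u x q) (*-congʳ u^q≈u)) a^q≈a)) (sym (-‿+-comm (u * x) a)) ⟩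
      u * x ^ q + a + (- (u * x) + - a)         ≈⟨ solve 4 (λ a b c d → a :+ b :+ (c :+ d) := a :+ c :+ (b :+ d)) refl _ a _ (- a) ⟩
      u * x ^ q + - (u * x) + (a - a)           ≈⟨ trans (+-congˡ (-‿inverseʳ a)) (+-identityʳ _) ⟩
      u * x ^ q + - (u * x)                     ≈⟨ +-congˡ (-‿distribʳ-* u x) ⟩
      u * x ^ q + u * - x                       ≈⟨ distribˡ u (x ^ q) (- x) ⟨
      u * ∂ x                                   ∎
      where open RingProperties ring using (-‿+-comm)

    Tr-affine : ∀ {u a} → u ^ q ≈ u → a ^ q ≈ a → ∀ x →
                Tr (c * (u * x + a) ^ R) ≈ u ^ R * Tr (c * x ^ R) + a ^ R * Tr c
    Tr-affine {u} {a} u^q≈u a^q≈a x = begin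
      Tr (c * (u * x + a) ^ R)                        ≈⟨ Tr-cong (*-congˡ (trans (^R-+ (u * x) a) (+-congʳ (^-distrib-* u x R)))) ⟩
      Tr (c * (u ^ R * x ^ R + a ^ R))                ≈⟨ Tr-cong (solve 4 (λ c u x a → c :* (u :* x :+ a) := u :* (c :* x) :+ a :* c) refl c _ _ _) ⟩
      Tr (u ^ R * (c * x ^ R) + a ^ R * c)            ≈⟨ Tr-+ _ _ ⟩
      Tr (u ^ R * (c * x ^ R)) + Tr (a ^ R * c)       ≈⟨ +-cong (Tr-* (^q-fixed-^ R u^q≈u) _) (Tr-* (^q-fixed-^ R a^q≈a) c) ⟩
      u ^ R * Tr (c * x ^ R) + a ^ R * Tr c           ∎

    -- On 𝔽_q the map ∂ vanishes, so f(a) = a^R Tr c there; with trace zero this identifies 0 and 1.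
    Permutes⇒Tr≉0 : Permutes (f Q R c) → Tr c ≉ 0#
    Permutes⇒Tr≉0 (inj , _) Tr≈0 = 1≉0 (inj (trans (f≈0 (1^n≈1 q)) (sym (f≈0 0^q≈0))))
      where
      0^q≈0 : 0# ^ q ≈ 0#
      0^q≈0 = trans (^-congʳ 0# (≡.sym (ℕ.suc-pred q {{ℕ.m^n≢0 p k}}))) (zeroˡ _)
      f≈0 : ∀ {a} → a ^ q ≈ a → eval (f Q R c) a ≈ 0#
      f≈0 {a} a^q≈a = begin
        eval (f Q R c) a                        ≈⟨ eval-f a ⟩
        ∂ a ^ (Q ℕ.+ 1) + Tr (c * a ^ R)        ≈⟨ +-cong (^-congˡ (Q ℕ.+ 1) (^q-fixed⇒∂≈0 a^q≈a)) (Tr-cong (*-comm c _)) ⟩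
        0# ^ (Q ℕ.+ 1) + Tr (a ^ R * c)         ≈⟨ +-cong (^-congʳ 0# (ℕ.+-comm Q 1)) (Tr-* (^q-fixed-^ R a^q≈a) c) ⟩
        0# * 0# ^ Q + a ^ R * Tr c              ≈⟨ +-cong (zeroˡ _) (trans (*-congˡ Tr≈0) (zeroʳ _)) ⟩
        0# + 0#                                 ≈⟨ +-identityʳ 0# ⟩
        0#                                      ∎

    -- In the fixed field of x ↦ x^q the map x ↦ x^(p^(k m)) is the identity,
    -- so x ↦ x^(p^((k - 1) m)) inverts x ↦ x^R.
    R-th-root : ∀ {b} → b ^ q ≈ b → ∃[ a ] a ^ q ≈ a Prod.× a ^ R ≈ b
    R-th-root {b} b^q≈b = b ^ E , ^q-fixed-^ E b^q≈b , (begin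
      (b ^ E) ^ R        ≈⟨ ^-assocʳ b E R ⟩
      b ^ (E ℕ.* R)      ≈⟨ ^-congʳ b E*R≡q^m ⟩
      b ^ (q ℕ.^ m)      ≈⟨ iterate m ⟩
      b                  ∎)
      where
      E = p ℕ.^ (ℕ.pred k ℕ.* m)
      E*R≡q^m : E ℕ.* R ≡ q ℕ.^ m
      E*R≡q^m = ≡.trans (≡.sym (ℕ.^-distribˡ-+-* p (ℕ.pred k ℕ.* m) m))
        (≡.trans (≡.cong (p ℕ.^_) (≡.trans (ℕ.+-comm _ m) (≡.cong (ℕ._* m) (ℕ.suc-pred k {{ℕ.>-nonZero k>0}}))))
          (≡.sym (ℕ.^-*-assoc p k m)))
      iterate : ∀ n → b ^ (q ℕ.^ n) ≈ b
      iterate zero    = *-identityʳ b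
      iterate (suc n) = trans (sym (^-assocʳ b q (q ℕ.^ n))) (trans (^-congˡ (q ℕ.^ n) b^q≈b) (iterate n))

    -- For `collision`, with s = u^R and v the trace term of x: `b` is the required a^R, obtained by
    -- solving a linear equation over 𝔽_q.
    shift : Tr c ≉ 0# → ∀ {s v} → s ^ q ≈ s → v ^ q ≈ v →
            ∃[ b ] b ^ q ≈ b Prod.× Tr c * b + s * v ≈ v
    shift Tr≉0 {s} {v} s^q≈s v^q≈v = b , b^q≈b , b-solves
      where
      inv = inverse card Tr≉0
      b = proj₁ inv * (v - s * v)
      b-solves : Tr c * b + s * v ≈ v
      b-solves = begin
        Tr c * (proj₁ inv * (v - s * v)) + s * v      ≈⟨ +-congʳ (*-assoc _ _ _) ⟨
        Tr c * proj₁ inv * (v - s * v) + s * v        ≈⟨ +-congʳ (trans (*-congʳ (proj₂ inv)) (*-identityˡ _)) ⟩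
        v - s * v + s * v                             ≈⟨ +-assoc _ _ _ ⟩
        v + (- (s * v) + s * v)                       ≈⟨ trans (+-congˡ (-‿inverseˡ _)) (+-identityʳ v) ⟩
        v                                             ∎
      -- All coefficients lie in 𝔽_q, so b^q solves the same equation, whose solution is unique.
      b^q≈b : b ^ q ≈ b
      b^q≈b = *-cancelˡ card Tr≉0 (+-cancelʳ (s * v) _ _ (begin
        Tr c * b ^ q + s * v                          ≈⟨ +-cong (*-congʳ (Tr^q≈Tr c)) (*-cong s^q≈s v^q≈v) ⟨
        Tr c ^ q * b ^ q + s ^ q * v ^ q              ≈⟨ +-cong (^-distrib-* _ _ q) (^-distrib-* _ _ q) ⟨
        (Tr c * b) ^ q + (s * v) ^ q                  ≈⟨ ^q-+ _ _ ⟨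
        (Tr c * b + s * v) ^ q                        ≈⟨ ^-congˡ q b-solves ⟩
        v ^ q                                         ≈⟨ v^q≈v ⟩
        v                                             ≈⟨ b-solves ⟨
        Tr c * b + s * v                              ∎))
        where open RingProperties ring using (+-cancelʳ)

    -- Multiplying x by u preserves ∂ x ^ (Q + 1); adding a with a ^ q ≈ a leaves ∂
    -- unchanged and restores the trace term.
    collision : Tr c ≉ 0# → ∀ {u} → u ^ q ≈ u → u ^ (Q ℕ.+ 1) ≈ 1# → ∀ x →
                ∃[ a ] a ^ q ≈ a Prod.× eval (f Q R c) (u * x + a) ≈ eval (f Q R c) x
    collision Tr≉0 {u} u^q≈u u^[Q+1]≈1 x =
      let v = Tr (c * x ^ R)
          b , b^q≈b , b-solves = shift Tr≉0 (^q-fixed-^ R u^q≈u) (Tr^q≈Tr (c * x ^ R))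
          a , a^q≈a , a^R≈b = R-th-root b^q≈b
      in a , a^q≈a , (begin
      eval (f Q R c) (u * x + a)                                     ≈⟨ eval-f (u * x + a) ⟩
      ∂ (u * x + a) ^ (Q ℕ.+ 1) + Tr (c * (u * x + a) ^ R)           ≈⟨ +-cong (^-congˡ (Q ℕ.+ 1) (∂-affine u^q≈u a^q≈a x)) (Tr-affine u^q≈u a^q≈a x) ⟩
      (u * ∂ x) ^ (Q ℕ.+ 1) + (u ^ R * v + a ^ R * Tr c)             ≈⟨ +-cong (^-distrib-* u (∂ x) (Q ℕ.+ 1)) (trans (+-comm _ _) (+-congʳ (trans (*-congʳ a^R≈b) (*-comm _ _)))) ⟩
      u ^ (Q ℕ.+ 1) * ∂ x ^ (Q ℕ.+ 1) + (Tr c * b + u ^ R * v)       ≈⟨ +-cong (trans (*-congʳ u^[Q+1]≈1) (*-identityˡ _)) b-solves ⟩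
      ∂ x ^ (Q ℕ.+ 1) + v                                            ≈⟨ eval-f x ⟨
      eval (f Q R c) x                                               ∎)

    -- Injectivity turns a collision at `w` into u w + a₀ = w; applying ∂ gives u ∂ w = ∂ w, and ∂ w
    -- can be cancelled.
    Permutes⇒roots-of-unity-trivial : Permutes (f Q R c) → ∀ {u} → u ^ q ≈ u → u ^ (Q ℕ.+ 1) ≈ 1# → u ≈ 1#
    Permutes⇒roots-of-unity-trivial perm {u} u^q≈u u^[Q+1]≈1 = *-cancelˡ card ∂w≉0 (begin
      ∂ w * u           ≈⟨ *-comm _ u ⟩
      u * ∂ w           ≈⟨ ∂-affine u^q≈u (proj₁ (proj₂ ∃a)) w ⟨
      ∂ (u * w + a₀)    ≈⟨ ∂-cong (proj₁ perm (proj₂ (proj₂ ∃a))) ⟩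
      ∂ w               ≈⟨ *-identityʳ _ ⟨
      ∂ w * 1#          ∎)
      where
      -- As q - 1 < q³ - 1, some nonzero `w` has w^(q-1) ≠ 1, that is ∂ w ≠ 0.
      ∃w = ∃-^≉1 card′ 1≉0 (q ℕ.∸ 1) (ℕ.m<n⇒0<n∸m q>1) (ℕ.∸-monoˡ-< q<q³ (ℕ.<⇒≤ q>1))
      w = proj₁ ∃w
      ∃a = collision (Permutes⇒Tr≉0 perm) u^q≈u u^[Q+1]≈1 w
      a₀ = proj₁ ∃a
      ∂w≉0 : ∂ w ≉ 0#
      ∂w≉0 e = proj₂ (proj₂ ∃w) (*-cancelˡ card (proj₁ (proj₂ ∃w)) (begin
        w * w ^ (q ℕ.∸ 1)     ≈⟨ ^-congʳ w (ℕ.suc-pred q {{ℕ.m^n≢0 p k}}) ⟩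
        w ^ q                 ≈⟨ x∙y⁻¹≈ε⇒x≈y _ _ e ⟩
        w                     ≈⟨ *-identityʳ w ⟨
        w * 1#                ∎))

    -- If d ≠ 1 then M = (q³ - 1)/d is smaller than q³ - 1, so some nonzero `w` has w^M ≠ 1. The
    -- d-th power of w^M is 1; since d divides q - 1 and Q + 1, the element w^M is a forbidden root
    -- of unity in 𝔽_q.
    Permutes⇒gcd≡1 : Permutes (f Q R c) → gcd (q ℕ.∸ 1) (Q ℕ.+ 1) ≡ 1
    Permutes⇒gcd≡1 perm with gcd (q ℕ.∸ 1) (Q ℕ.+ 1) ℕ.≟ 1
    ... | yes d≡1 = d≡1
    ... | no  d≢1 = contradiction (Permutes⇒roots-of-unity-trivial perm u^q≈u (power (gcd[m,n]∣n (q ℕ.∸ 1) (Q ℕ.+ 1)))) w^M≉1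
      where
      d = gcd (q ℕ.∸ 1) (Q ℕ.+ 1)
      d∣q-1 = gcd[m,n]∣m (q ℕ.∸ 1) (Q ℕ.+ 1)
      d∣q³-1 = ∣-trans d∣q-1 (x-1∣x^j-1 q {{ℕ.m^n≢0 p k}} 3)
      M = _∣_.quotient d∣q³-1
      q³-1≡M*d : q ℕ.^ 3 ℕ.∸ 1 ≡ M ℕ.* d
      q³-1≡M*d = _∣_.equality d∣q³-1
      M*d≢0 : NonZero (M ℕ.* d)
      M*d≢0 = ℕ.>-nonZero (≡.subst (0 ℕ.<_) q³-1≡M*d (ℕ.m<n⇒0<n∸m (ℕ.<-trans q>1 q<q³)))
      instance
        M≢0 : NonZero M
        M≢0 = ℕ.m*n≢0⇒m≢0 M {{M*d≢0}}
      d>1 : 1 ℕ.< d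
      d>1 = ℕ.≤∧≢⇒< (ℕ.>-nonZero⁻¹ d {{ℕ.m*n≢0⇒n≢0 M {{M*d≢0}}}}) (λ e → d≢1 (≡.sym e))
      M<q³-1 : M ℕ.< q ℕ.^ 3 ℕ.∸ 1
      M<q³-1 = ≡.subst (M ℕ.<_) (≡.sym q³-1≡M*d) (ℕ.m<m*n M d d>1)
      ∃w = ∃-^≉1 card′ 1≉0 M (ℕ.>-nonZero⁻¹ M) M<q³-1
      w = proj₁ ∃w
      w^M≉1 = proj₂ (proj₂ ∃w)
      power : ∀ {n} → d ∣ n → (w ^ M) ^ n ≈ 1#
      power (divides i ≡.refl) = begin
        (w ^ M) ^ (i ℕ.* d)             ≈⟨ ^-congʳ _ (ℕ.*-comm i d) ⟩
        (w ^ M) ^ (d ℕ.* i)             ≈⟨ ^-assocʳ (w ^ M) d i ⟨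
        ((w ^ M) ^ d) ^ i               ≈⟨ ^-congˡ i (^-assocʳ w M d) ⟩
        (w ^ (M ℕ.* d)) ^ i             ≈⟨ ^-congˡ i (^-congʳ w q³-1≡M*d) ⟨
        (w ^ (q ℕ.^ 3 ℕ.∸ 1)) ^ i       ≈⟨ ^-congˡ i (^-card-1 card′ 1≉0 (proj₁ (proj₂ ∃w))) ⟩
        1# ^ i                          ≈⟨ 1^n≈1 i ⟩
        1#                              ∎
      u^q≈u : (w ^ M) ^ q ≈ w ^ M
      u^q≈u = begin
        (w ^ M) ^ q                     ≈⟨ ^-congʳ (w ^ M) (ℕ.suc-pred q {{ℕ.m^n≢0 p k}}) ⟨
        w ^ M * (w ^ M) ^ (q ℕ.∸ 1)     ≈⟨ *-congˡ (power d∣q-1) ⟩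
        w ^ M * 1#                      ≈⟨ *-identityʳ _ ⟩
        w ^ M                           ∎

-- Sufficiency: for p = 2 the order and trace conditions make f injective.

module Sufficiency (k ℓ m : ℕ) (k>0 : k ℕ.> 0)
  (F : HeytingField a ℓ₁ ℓ₂)
  (card : HasCardinality (CubicExtension.fieldSetoid F (2 ℕ.^ k)) ((2 ℕ.^ k) ℕ.^ 3))
  (c : HeytingField.Carrier F) where

  private
    q = 2 ℕ.^ k
    Q = 2 ℕ.^ ℓ
    R = 2 ℕ.^ m
    N = Q ℕ.+ 1

    K : CommutativeRing _ _
    K = HeytingCommutativeRing.commutativeRing (HeytingField.heytingCommutativeRing F)

  open CubicExtension F q using (fieldSetoid; f; Tr; eval; Permutes)
  open CubicTrace prime[2] k ℓ m k>0 F card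
  open CommutativeRing K hiding (zero)
  open Exp commutativeSemiring
  open SemiringSolver commutativeSemiring using (solve; _:+_; _:=_)
  open CharacteristicTwo K p×1≈0
  open FiniteField F using (cancel; ^≈0⇒≈0)
  open PolynomialEvaluation K using (eval-cong; [x^m]^n≈[x^n]^m)
  open FiniteSetoid setoid card using (injective⇒bijective)
  open RingProperties ring using (+-cancelˡ)
  open SetoidReasoning setoid

  x-y≈x+y : ∀ x y → x - y ≈ x + y
  x-y≈x+y x y = +-congˡ (trans (x+y≈z⇒x≈z+y (-‿inverseˡ y)) (+-identityˡ y))

  ∂≈ : ∀ x → ∂ x ≈ x ^ q + x
  ∂≈ x = x-y≈x+y (x ^ q) x

  -- This is the vanishing of the trace of ∂ x, rearranged in characteristic two; it is the relation
  -- y^q = x + y that `invariants-determine` asks for.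
  [∂x^q]^q≈∂x+∂x^q : ∀ x → (∂ x ^ q) ^ q ≈ ∂ x + ∂ x ^ q
  [∂x^q]^q≈∂x+∂x^q x = begin
    (∂ x ^ q) ^ q                                 ≈⟨ ^-congˡ q ∂x^q≈ ⟩
    ((x ^ q) ^ q + x ^ q) ^ q                     ≈⟨ ^q-+ _ _ ⟩
    ((x ^ q) ^ q) ^ q + (x ^ q) ^ q               ≈⟨ +-congʳ ([x^q^q]^q≈x x) ⟩
    x + (x ^ q) ^ q                               ≈⟨ x+y+y≈x _ (x ^ q) ⟨
    x + (x ^ q) ^ q + x ^ q + x ^ q               ≈⟨ solve 3 (λ x y z → x :+ z :+ y :+ y := y :+ x :+ (z :+ y)) refl x _ _ ⟩
    x ^ q + x + ((x ^ q) ^ q + x ^ q)             ≈⟨ +-cong (∂≈ x) ∂x^q≈ ⟨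
    ∂ x + ∂ x ^ q                                 ∎
    where
    ∂x^q≈ : ∂ x ^ q ≈ (x ^ q) ^ q + x ^ q
    ∂x^q≈ = trans (^-congˡ q (∂≈ x)) (^q-+ (x ^ q) x)

  α : Carrier → Carrier
  α x = ∂ x ^ N + (∂ x ^ q) ^ N

  -- The second sum in `invariants-determine` is a conjugate of the first, so it is determined as
  -- soon as `α x` is.
  β≈α^q : ∀ x → (∂ x ^ q) ^ N + (∂ x + ∂ x ^ q) ^ N ≈ α x ^ q
  β≈α^q x = begin
    (∂ x ^ q) ^ N + (∂ x + ∂ x ^ q) ^ N         ≈⟨ +-congˡ (^-congˡ N ([∂x^q]^q≈∂x+∂x^q x)) ⟨
    (∂ x ^ q) ^ N + ((∂ x ^ q) ^ q) ^ N         ≈⟨ +-cong ([x^m]^n≈[x^n]^m (∂ x) q N) ([x^m]^n≈[x^n]^m (∂ x ^ q) q N) ⟩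
    (∂ x ^ N) ^ q + ((∂ x ^ q) ^ N) ^ q         ≈⟨ ^q-+ _ _ ⟨
    α x ^ q                                     ∎

  -- The trace term lies in 𝔽_q, hence cancels from f(x) + f(x)^q and leaves `α x`.
  α-determined : ∀ {x z} → eval (f Q R c) x ≈ eval (f Q R c) z → α x ≈ α z
  α-determined {x} {z} fx≈fz = begin
    α x                                              ≈⟨ α≈ x ⟩
    eval (f Q R c) x + eval (f Q R c) x ^ q          ≈⟨ +-cong fx≈fz (^-congˡ q fx≈fz) ⟩
    eval (f Q R c) z + eval (f Q R c) z ^ q          ≈⟨ α≈ z ⟨
    α z                                              ∎
    where
    α≈ : ∀ x → α x ≈ eval (f Q R c) x + eval (f Q R c) x ^ q
    α≈ x = begin
      ∂ x ^ N + (∂ x ^ q) ^ N                        ≈⟨ x+y+y≈x _ v ⟨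
      ∂ x ^ N + (∂ x ^ q) ^ N + v + v                ≈⟨ solve 3 (λ g h v → g :+ h :+ v :+ v := g :+ v :+ (h :+ v)) refl _ _ v ⟩
      ∂ x ^ N + v + ((∂ x ^ q) ^ N + v)              ≈⟨ +-congˡ (+-cong ([x^m]^n≈[x^n]^m (∂ x) N q) (Tr^q≈Tr (c * x ^ R))) ⟨
      ∂ x ^ N + v + ((∂ x ^ N) ^ q + v ^ q)          ≈⟨ +-congˡ (^q-+ _ _) ⟨
      ∂ x ^ N + v + (∂ x ^ N + v) ^ q                ≈⟨ +-cong (eval-f c x) (^-congˡ q (eval-f c x)) ⟨
      eval (f Q R c) x + eval (f Q R c) x ^ q        ∎
      where v = Tr (c * x ^ R)

  module _ (ord≤ : ord₂ k ≤⁺ ord₂ ℓ) (Tr≉0 : Tr c ≉ 0#) where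

    ∂-determined : ∀ {x z} → eval (f Q R c) x ≈ eval (f Q R c) z → ∂ x ≈ ∂ z
    ∂-determined {x} {z} fx≈fz =
      let s , o , j , k≡ , ℓ≡ = ord₂-≤⇒split k ℓ k>0 ord≤
          αx≈αz = α-determined fx≈fz
      in invariants-determine k ℓ s o j k≡ ℓ≡ fixed
        refl ([∂x^q]^q≈∂x+∂x^q x) refl ([∂x^q]^q≈∂x+∂x^q z)
        αx≈αz (trans (β≈α^q x) (trans (^-congˡ q αx≈αz) (sym (β≈α^q z))))
      where
      fixed : ∀ z → z ^ (2 ℕ.^ (3 ℕ.* k)) ≈ z
      fixed z = trans (^-congʳ z (≡.trans (≡.cong (2 ℕ.^_) (ℕ.*-comm 3 k)) (≡.sym (ℕ.^-*-assoc 2 k 3)))) (x^q³≈x z)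

    f-injective : Injective _≈_ _≈_ (eval (f Q R c))
    f-injective {x} {z} fx≈fz = trans (x+y≈z⇒x≈z+y δ≈0) (+-identityˡ z)
      where
      -- In characteristic two this is x - z; equality of ∂ x and ∂ z places it in 𝔽_q.
      δ = x + z
      ∂x≈∂z = ∂-determined fx≈fz
      δ^q≈δ : δ ^ q ≈ δ
      δ^q≈δ = begin
        (x + z) ^ q                        ≈⟨ x+y+y≈x _ (x + z) ⟨
        (x + z) ^ q + (x + z) + (x + z)    ≈⟨ +-congʳ (+-congʳ (^q-+ x z)) ⟩
        x ^ q + z ^ q + (x + z) + (x + z)  ≈⟨ +-congʳ (solve 4 (λ a b c d → a :+ b :+ (c :+ d) := a :+ c :+ (b :+ d)) refl _ _ x z) ⟩
        x ^ q + x + (z ^ q + z) + (x + z)  ≈⟨ +-congʳ (+-cong (∂≈ x) (∂≈ z)) ⟨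
        ∂ x + ∂ z + (x + z)                ≈⟨ +-congʳ (trans (+-congʳ ∂x≈∂z) (x+x≈0 (∂ z))) ⟩
        0# + (x + z)                       ≈⟨ +-identityˡ _ ⟩
        x + z                              ∎
      Tr≈Tr : Tr (c * x ^ R) ≈ Tr (c * z ^ R)
      Tr≈Tr = +-cancelˡ (∂ x ^ N) _ _ (begin
        ∂ x ^ N + Tr (c * x ^ R)           ≈⟨ eval-f c x ⟨
        eval (f Q R c) x                   ≈⟨ fx≈fz ⟩
        eval (f Q R c) z                   ≈⟨ eval-f c z ⟩
        ∂ z ^ N + Tr (c * z ^ R)           ≈⟨ +-congʳ (^-congˡ N ∂x≈∂z) ⟨
        ∂ x ^ N + Tr (c * z ^ R)           ∎)
      δ≈0 : δ ≈ 0#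
      -- The trace terms of x and z agree, so Tr (c δ^R) = 0; as δ^R lies in 𝔽_q, it comes out of
      -- the trace, and Tr c ≠ 0 can be cancelled.
      δ≈0 = ^≈0⇒≈0 card 1≉0 R (cancel card (begin
        Tr c * δ ^ R                       ≈⟨ *-comm _ _ ⟩
        δ ^ R * Tr c                       ≈⟨ Tr-* (^q-fixed-^ c R δ^q≈δ) c ⟨
        Tr (δ ^ R * c)                     ≈⟨ Tr-cong (*-comm _ c) ⟩
        Tr (c * δ ^ R)                     ≈⟨ Tr-cong (trans (*-congˡ (^R-+ c x z)) (distribˡ c _ _)) ⟩
        Tr (c * x ^ R + c * z ^ R)         ≈⟨ Tr-+ _ _ ⟩
        Tr (c * x ^ R) + Tr (c * z ^ R)    ≈⟨ trans (+-congʳ Tr≈Tr) (x+x≈0 _) ⟩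
        0#                                 ∎) Tr≉0)

    f-permutes : Permutes (f Q R c)
    f-permutes = injective⇒bijective (eval-cong (f Q R c)) f-injective

-- The cycle of implications that gives both equivalences.

open import Data.Nat.Base using (_+_; _∸_; _^_; _>_)
open import Data.Product.Base using (_×_)

theorem1p4 : ∀ {a ℓ₁ ℓ₂} (p k ℓ m : ℕ) → Prime p → k > 0 →
    let q = p ^ k
        Q = p ^ ℓ
        R = p ^ m
    in
    (F : HeytingField a ℓ₁ ℓ₂) →
    let open CubicExtension F q in
    HasCardinality fieldSetoid (q ^ 3) →
    (c : Carrier) →
      (Permutes (f Q R c) ⇔ (gcd (q ∸ 1) (Q + 1) ≡ 1 × Tr c ≉ 0#)) ×
      (Permutes (f Q R c) ⇔ (p ≡ 2 × ord₂ k ≤⁺ ord₂ ℓ × Tr c ≉ 0#))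
theorem1p4 p k ℓ m pr k>0 F card c =
  mk⇔ necessary (λ (g≡1 , Tr≉0) → sufficient (gcd⇒ord g≡1 .proj₁ , gcd⇒ord g≡1 .proj₂ , Tr≉0)) ,
  mk⇔ (λ perm → let g≡1 , Tr≉0 = necessary perm in gcd⇒ord g≡1 .proj₁ , gcd⇒ord g≡1 .proj₂ , Tr≉0) sufficient
  where
  q = p ^ k
  Q = p ^ ℓ
  R = p ^ m
  open CubicExtension F q
  necessary : Permutes (f Q R c) → gcd (q ∸ 1) (Q + 1) ≡ 1 × Tr c ≉ 0#
  necessary perm = Permutes⇒gcd≡1 c perm , Permutes⇒Tr≉0 c perm
    where open CubicTrace pr k ℓ m k>0 F card
  gcd⇒ord : gcd (q ∸ 1) (Q + 1) ≡ 1 → p ≡ 2 × ord₂ k ≤⁺ ord₂ ℓ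
  gcd⇒ord g≡1 with gcd≡1⇒p≡2 p k ℓ pr g≡1
  ... | ≡.refl = ≡.refl , gcd≡1⇒ord₂-≤ k ℓ k>0 g≡1
  sufficient : p ≡ 2 × ord₂ k ≤⁺ ord₂ ℓ × Tr c ≉ 0# → Permutes (f Q R c)
  sufficient (≡.refl , ord≤ , Tr≉0) = Sufficiency.f-permutes k ℓ m k>0 F card c ord≤ Tr≉0
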